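{- Let $p\ge5$ be prime and $A,B\in\mathbb{N}$, put $f(x)=x^3+Ax+B$ and $\Delta=4A^3+27B^2$. Suppose $p\mid\Delta$ and $p\nmid A$, and let $m=v_p(\Delta)\in\{1,2,\dots\}\cup\{\infty\}$ and $\eta=\left(\frac{ -2AB}{p}\right)\in\{\pm1\}$. Let $\rho\in\mathbb{F}_p$ be the unique repeated root of $f$ modulo $p$, and for $k\ge1$ let $M_k$ be the number of $(x,y)\in(\mathbb{Z}/p^k\mathbb{Z})^2$ with $y^2=f(x)$ in $\mathbb{Z}/p^k\mathbb{Z}$ and $(x,y)\equiv(\rho,0)\pmod p$. Then for every $k\ge1$, \[ \eta=+1:\qquad M_k=\begin{cases} p^{\,k-1}\bigl((k-1)p-(k-2)\bigr), & k\le m,\\ p^{\,k-1}(m-1)(p-1), & k>m;\end{cases} \] \[ \eta=-1:\qquad M_k=\begin{cases} p^{\,2\lfloor k/2\rfloor}, & k\le m,\\ 0, & k>m,\ m\text{ odd},\\ p^{\,k-1}(p+1), & k>m,\ m\text{ even}.\end{cases} \]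
   Context: $\mathbb{N}$ includes $0$. $v_p$ is the $p$-adic valuation with $v_p(0)=\infty$; when $m=\infty$ the case $k\le m$ always applies. $\left(\frac{\cdot}{p}\right)$ is the Legendre symbol. Under the hypotheses, $f$ modulo $p$ has exactly one repeated root $\rho=-3B/(2A)\in\mathbb{F}_p$, it is a nonzero double root, and $(\rho,0)$ is the unique singular point (a node) of the reduced curve $y^2=f(x)$ over $\mathbb{F}_p$. -}

module Defs where

open import Data.Bool.Base using (if_then_else_)
open import Data.Fin.Base using (Fin; toℕ)
open import Data.Fin.Properties using (any?)
open import Data.Integer.Base using (ℤ; +_; -_; _+_; _*_; _-_; _^_; ∣_∣; 0ℤ; 1ℤ; -1ℤ)
open import Data.Integer.Divisibility using (_∣_)
open import Data.List.Base
  using (List; []; _∷_; map; length; filter; allFin; cartesianProduct)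
open import Data.Nat.Base as ℕ using (ℕ; zero; suc)
import Data.Nat.Divisibility as ℕ
open import Data.Product.Base using (_×_; _,_; ∃)
open import Relation.Binary.Construct.Add.Supremum.NonStrict ℕ._≤_ public
  using () renaming (_≤⁺_ to _≤∞_)
open import Relation.Binary.PropositionalEquality using (_≡_)
open import Relation.Nullary using (¬_; Dec)
open import Relation.Nullary.Decidable using (⌊_⌋; _×-dec_)
open import Relation.Nullary.Construct.Add.Supremum public
  using (_⁺) renaming ([_] to fin; ⊤⁺ to ∞)

-- Elements of ℤ/nℤ are written as elements of Fin n and compared, through
-- their representatives in ℤ, by congruence modulo n.

infix 4 _≡_[mod_] _≡?_[mod_] _≡ₚ_[mod_]

_≡_[mod_] : ℤ → ℤ → ℕ → Set
a ≡ b [mod n ] = + n ∣ a - b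

_≡?_[mod_] : ∀ a b n → Dec (a ≡ b [mod n ])
a ≡? b [mod n ] = n ℕ.∣? ∣ a - b ∣

rep : ∀ {n} → Fin n → ℤ
rep i = + toℕ i

-- Polynomials over ℤ: coefficient lists, constant term first.

Poly : Set
Poly = List ℤ

infixl 6 _⊕_
infixl 7 _⊗_

coeff : Poly → ℕ → ℤ
coeff []      _       = 0ℤ
coeff (a ∷ _) zero    = a
coeff (_ ∷ P) (suc i) = coeff P i

eval : Poly → ℤ → ℤ
eval []      _ = 0ℤ
eval (a ∷ P) x = a + x * eval P x

_⊕_ : Poly → Poly → Poly
[]      ⊕ Q       = Q
(a ∷ P) ⊕ []      = a ∷ P
(a ∷ P) ⊕ (b ∷ Q) = (a + b) ∷ (P ⊕ Q)

_⊗_ : Poly → Poly → Poly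
[]      ⊗ _ = []
(a ∷ P) ⊗ Q = map (a *_) Q ⊕ (0ℤ ∷ P ⊗ Q)

-- Equality of the reductions in (ℤ/nℤ)[X].
_≡ₚ_[mod_] : Poly → Poly → ℕ → Set
P ≡ₚ Q [mod n ] = ∀ i → coeff P i ≡ coeff Q i [mod n ]

X-_ : ℤ → Poly
X- a = - a ∷ 1ℤ ∷ []

-- (X − ρ)² divides P in 𝔽ₚ[X].
RepeatedRoot : (p : ℕ) → Poly → Fin p → Set
RepeatedRoot p P ρ = ∃ λ Q → P ≡ₚ (X- rep ρ) ⊗ (X- rep ρ) ⊗ Q [mod p ]

cubic : ℕ → ℕ → Poly
cubic A B = + B ∷ + A ∷ 0ℤ ∷ 1ℤ ∷ []

Δ : ℕ → ℕ → ℕ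
Δ A B = 4 ℕ.* A ℕ.^ 3 ℕ.+ 27 ℕ.* B ℕ.^ 2

ℕ∞ : Set
ℕ∞ = ℕ ⁺

-- HasValuation p n m  says  vₚ(n) = m.
HasValuation : ℕ → ℕ → ℕ∞ → Set
HasValuation p n (fin m) = p ℕ.^ m ℕ.∣ n × ¬ (p ℕ.^ suc m ℕ.∣ n)
HasValuation p n ∞       = n ≡ 0

legendre : ℤ → ℕ → ℤ
legendre a p =
  if ⌊ a ≡? 0ℤ [mod p ] ⌋ then 0ℤ
  else if ⌊ any? {p} (λ x → rep x ^ 2 ≡? a [mod p ]) ⌋ then 1ℤ
  else -1ℤ

OnCurveAbove : ∀ {p} → Poly → Fin p → ∀ k → Fin (p ℕ.^ k) × Fin (p ℕ.^ k) → Set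
OnCurveAbove {p} f ρ k (x , y) =
  rep y ^ 2 ≡ eval f (rep x) [mod p ℕ.^ k ] ×
  rep x ≡ rep ρ [mod p ] ×
  rep y ≡ 0ℤ [mod p ]

onCurveAbove? : ∀ {p} f (ρ : Fin p) k xy → Dec (OnCurveAbove f ρ k xy)
onCurveAbove? {p} f ρ k (x , y) =
  (rep y ^ 2 ≡? eval f (rep x) [mod p ℕ.^ k ]) ×-dec
  (rep x ≡? rep ρ [mod p ]) ×-dec
  (rep y ≡? 0ℤ [mod p ])

M : ∀ {p} → Poly → Fin p → ℕ → ℕ
M {p} f ρ k =
  length (filter (onCurveAbove? f ρ k)
                 (cartesianProduct (allFin (p ℕ.^ k)) (allFin (p ℕ.^ k))))

{-# OPTIONS --safe #-}
-- Let c be the zero of f′ above ρ, found by Newton's iteration to precision pᵏ.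
-- Then f(c + u) = δ + u²(3c + u) with δ = f(c), and 27(B + 2c³)δ ≡ Δ with
-- p ∤ 27(B + 2c³), so δ and Δ are divisible by the same powers pʲ with j ≤ k.
-- Solutions of y² = δ + u²(3c + u) with p ∣ u, y exist for k ≥ 2 only if p² ∣ δ.
-- Dividing u and y by p then gives p² times the count modulo pᵏ⁻² of all
-- solutions of y² = δ/p² + u²(3c + pu): those above (0,0) are counted by
-- recursion, the others are smooth, and each lifts in p ways from pʲ to pʲ⁺¹.
-- The conic y² = δ + 3cu² has, away from (0,0), p − 1 or 2(p − 1) points over 𝔽ₚ
-- if 3c is a square and p + 1 or 0 if not (according as p ∤ δ or p ∣ δ),
-- and −2AB ≡ 3c(2c²)² modulo p.
module Submission where

open import Defs
open import Algebra.Properties.Semiring.Sum as Sum using ()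
open import Data.Fin.Base using (Fin; zero; suc; toℕ; fromℕ<)
open import Data.Fin.Permutation using (permutation)
open import Data.Fin.Properties using (toℕ-injective; toℕ-fromℕ<; toℕ<n; any?)
open import Data.Integer.Base
  using (ℤ; +_; -_; _+_; _*_; _-_; _^_; ∣_∣; 0ℤ; 1ℤ; -1ℤ)
open import Data.Integer.Divisibility.Signed using (∣ᵤ⇒∣; ∣⇒∣ᵤ; divides)
open import Data.Integer.DivMod using (_%ℕ_; _/ℕ_; n%ℕd<d; a≡a%ℕn+[a/ℕn]*n)
import Data.Integer.Properties as ℤ
open import Data.Integer.Tactic.RingSolver using (solve; solve-∀)
open import Data.List.Base
  using (List; []; _∷_; _++_; map; length; filter; tabulate; cartesianProduct)
open import Data.List.Properties using (length-++; filter-++; map-tabulate)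
open import Data.Nat.Base as ℕ using (ℕ; zero; suc; NonZero; _≤_; _<_; _∸_; _/_)
open import Data.Nat.Coprimality using (coprime-Bézout; prime⇒coprime)
open import Data.Nat.Divisibility as ℕ using (_∣_; ∣m+n∣m⇒∣n; ∣⇒≤)
open import Data.Nat.DivMod using (m/n≡1+[m∸n]/n)
open import Data.Nat.GCD using (module Bézout)
open import Data.Nat.Primality using (Prime; euclidsLemma; prime⇒nonZero)
import Data.Nat.Properties as ℕ
import Data.Nat.Tactic.RingSolver as ℕ
open import Data.Product.Base using (_×_; _,_; ∃; proj₁; proj₂)
open import Data.Sum.Base using (_⊎_; inj₁; inj₂)
open import Function.Base using (_∘_; case_of_)
open import Relation.Binary.Construct.Add.Supremum.NonStrict ℕ._≤_ using ([_])
open import Relation.Binary.PropositionalEquality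
  using (_≡_; refl; sym; trans; cong; cong₂; subst; subst₂; module ≡-Reasoning)
open import Relation.Nullary using (¬_; Dec; yes; no; contradiction)
open import Relation.Nullary.Decidable using (_×-dec_; ¬?; map′)

-- A p-adic zero of f′ would serve every k at once. Over ℤ, c and δ depend on k, and δ is compared
-- with Δ only up to the exponent k. This suffices: the case k ≤ m asks only whether p^k divides δ
-- (m = ∞ included), and the case m < k tests the exponents m and m + 1, both at most k. The cubic
-- coefficient b has to be free, because dividing by p² replaces b by pb. The curve with b = 1 is
-- only ever counted above its node; every smooth point that enters lies on a curve with p ∣ b,
-- which reduces to a conic. Each division lowers exponent and valuation by 2, so the recursion ends
-- at exponents 1 and 2 or at valuations 0 and 1. The type of the node enters only through the conic
-- counts s₀ (p ∣ δ) and s₁ (p ∤ δ), so one recursion serves both signs of η. Relative to p^(k-1),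
-- each step adds s₀. For η = 1 this gives linear growth; for η = -1 it adds 0, and only the parity
-- of the exponent or the valuation survives.

infix 4 _≈_[_] _≈?_[_]

-- A record keeps `a`, `b` and `n` visible to unification, whereas `_≡_[mod_]` unfolds to
-- divisibility of an absolute value. The modulus is an integer so that it can be a variable of the
-- ring solver; the stored quotient is the error term that lifting corrects.
record _≈_[_] (a b n : ℤ) : Set where
  constructor congruent
  field
    quotient : ℤ
    equality : a - b ≡ n * quotient

-- Congruences are derived as explicit linear combinations of hypotheses: the caller supplies the
-- cofactors, and the ring solver checks the resulting identity in ℤ.
lin₁ : ∀ {a b x y n} u → a ≈ b [ n ] → x - y ≡ u * (a - b) → x ≈ y [ n ]
lin₁ {n = n} u (congruent s r) e =
  congruent (u * s) (trans e (trans (cong (u *_) r) (solve (u ∷ n ∷ s ∷ []))))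

lin₂ : ∀ {a b c d x y n} u v → a ≈ b [ n ] → c ≈ d [ n ] →
       x - y ≡ u * (a - b) + v * (c - d) → x ≈ y [ n ]
lin₂ {n = n} u v (congruent s r) (congruent s′ r′) e =
  congruent (u * s + v * s′)
    (trans e (trans (cong₂ _+_ (cong (u *_) r) (cong (v *_) r′))
                    (solve (u ∷ v ∷ n ∷ s ∷ s′ ∷ []))))

lin₃ : ∀ {a b c d e f x y n} u v w →
       a ≈ b [ n ] → c ≈ d [ n ] → e ≈ f [ n ] →
       x - y ≡ u * (a - b) + v * (c - d) + w * (e - f) → x ≈ y [ n ]
lin₃ {n = n} u v w (congruent s r) (congruent s′ r′) (congruent s″ r″) eq =
  congruent (u * s + v * s′ + w * s″)
    (trans eq (trans (cong₂ _+_ (cong₂ _+_ (cong (u *_) r) (cong (v *_) r′)) (cong (w *_) r″))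
                     (solve (u ∷ v ∷ w ∷ n ∷ s ∷ s′ ∷ s″ ∷ []))))

module _ {n : ℤ} where

  ≈-reflexive : ∀ {a b} → a ≡ b → a ≈ b [ n ]
  ≈-reflexive {a} refl = congruent 0ℤ (trans (ℤ.+-inverseʳ a) (sym (ℤ.*-zeroʳ n)))

  ≈-refl : ∀ {a} → a ≈ a [ n ]
  ≈-refl = ≈-reflexive refl

  ≈-sym : ∀ {a b} → a ≈ b [ n ] → b ≈ a [ n ]
  ≈-sym {a} {b} h = lin₁ -1ℤ h (solve (a ∷ b ∷ []))

  ≈-trans : ∀ {a b c} → a ≈ b [ n ] → b ≈ c [ n ] → a ≈ c [ n ]
  ≈-trans {a} {b} {c} h h′ = lin₂ 1ℤ 1ℤ h h′ (solve (a ∷ b ∷ c ∷ []))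

  ≈-multiple : ∀ t → n * t ≈ 0ℤ [ n ]
  ≈-multiple t = congruent t (ℤ.+-identityʳ _)

≈-weaken : ∀ {a b m} n → a ≈ b [ m * n ] → a ≈ b [ m ]
≈-weaken {m = m} n (congruent s r) = congruent (n * s) (trans r (ℤ.*-assoc m n s))

≈-scale : ∀ {a b m} n → a ≈ b [ m ] → n * a ≈ n * b [ n * m ]
≈-scale {a} {b} {m} n (congruent s r) = congruent s (begin
  n * a - n * b  ≡⟨ solve (a ∷ b ∷ n ∷ []) ⟩
  n * (a - b)    ≡⟨ cong (n *_) r ⟩
  n * (m * s)    ≡⟨ ℤ.*-assoc n m s ⟨
  n * m * s      ∎)
  where open ≡-Reasoning

≈-unscale : ∀ {a b m} n .{{_ : NonZero n}} →
            + n * a ≈ + n * b [ + n * m ] → a ≈ b [ m ]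
≈-unscale {a} {b} {m} n@(suc _) (congruent s r) = congruent s
  (ℤ.*-cancelˡ-≡ (+ n) (a - b) (m * s) (begin
    + n * (a - b)      ≡⟨ distrib (+ n) ⟩
    + n * a - + n * b  ≡⟨ r ⟩
    + n * m * s        ≡⟨ ℤ.*-assoc (+ n) m s ⟩
    + n * (m * s)      ∎))
  where
  open ≡-Reasoning
  distrib : ∀ n → n * (a - b) ≡ n * a - n * b
  distrib n = solve (a ∷ b ∷ n ∷ [])

≡mod⇒≈ : ∀ {a b n} → a ≡ b [mod n ] → a ≈ b [ + n ]
≡mod⇒≈ {a} {b} {n} h with divides s r ← ∣ᵤ⇒∣ {+ n} {a - b} h =
  congruent s (trans r (ℤ.*-comm s (+ n)))

≈⇒≡mod : ∀ {a b n} → a ≈ b [ + n ] → a ≡ b [mod n ]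
≈⇒≡mod {a} {b} {n} (congruent s r) =
  ∣⇒∣ᵤ {+ n} {a - b} (divides s (trans r (ℤ.*-comm (+ n) s)))

abstract
  -- Opaque, so that the indicator sums below stay symbolic and do not unfold into a divisibility
  -- test.
  _≈?_[_] : ∀ a b n → Dec (a ≈ b [ n ])
  a ≈? b [ n ] with ∣ n ∣ ℕ.∣? ∣ a - b ∣
  ... | yes h with divides s r ← ∣ᵤ⇒∣ {n} {a - b} h =
    yes (congruent s (trans r (ℤ.*-comm s n)))
  ... | no h = no λ where
    (congruent s r) → h (∣⇒∣ᵤ {n} {a - b} (divides s (trans r (ℤ.*-comm n s))))

∣⇒≈0 : ∀ {n a} → n ℕ.∣ ∣ a ∣ → a ≈ 0ℤ [ + n ]
∣⇒≈0 {n} {a} h = ≡mod⇒≈ (subst (λ x → n ℕ.∣ ∣ x ∣) (sym (ℤ.+-identityʳ a)) h)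

≈0⇒∣ : ∀ {n a} → a ≈ 0ℤ [ + n ] → n ℕ.∣ ∣ a ∣
≈0⇒∣ {n} {a} h = subst (λ x → n ℕ.∣ ∣ x ∣) (ℤ.+-identityʳ a) (≈⇒≡mod {a} {0ℤ} h)

-- The representatives of ℤ/nℤ

residue : ∀ n .{{_ : NonZero n}} → ℤ → Fin n
residue n a = fromℕ< (n%ℕd<d a n)

rep-residue : ∀ n .{{_ : NonZero n}} a → rep (residue n a) ≈ a [ + n ]
rep-residue n a = lemma (+ n) (rep (residue n a)) (a /ℕ n)
  (trans (a≡a%ℕn+[a/ℕn]*n a n)
    (cong (λ r → + r + a /ℕ n * + n) (sym (toℕ-fromℕ< (n%ℕd<d a n)))))
  where
  lemma : ∀ m r s → a ≡ r + s * m → r ≈ a [ m ]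
  lemma m r s refl = congruent (- s) (solve (r ∷ m ∷ s ∷ []))

rep-injective : ∀ {n} {i j : Fin n} → rep i ≈ rep j [ + n ] → i ≡ j
rep-injective {n} {i} {j} h = toℕ-injective (ℤ.+-injective
  (ℤ.i-j≡0⇒i≡j (rep i) (rep j) (ℤ.∣i∣≡0⇒i≡0 (small (≈⇒≡mod {rep i} {rep j} h)))))
  where
  bound : ∣ rep i - rep j ∣ < n
  bound = ℕ.≤-<-trans
    (subst (λ d → ∣ d ∣ ≤ toℕ i ℕ.⊔ toℕ j) (sym (ℤ.m-n≡m⊖n (toℕ i) (toℕ j)))
      (ℤ.∣m⊝n∣≤m⊔n (toℕ i) (toℕ j)))
    (ℕ.⊔-lub (toℕ<n i) (toℕ<n j))
  small : n ℕ.∣ ∣ rep i - rep j ∣ → ∣ rep i - rep j ∣ ≡ 0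
  small h with ∣ rep i - rep j ∣ | bound
  ... | zero  | _ = refl
  ... | suc d | b = contradiction h (ℕ.>⇒∤ b)

-- Arithmetic modulo a prime

module _ {p} (pr : Prime p) where

  private instance
    p≢0 : NonZero p
    p≢0 = prime⇒nonZero pr

  ≈0-split : ∀ x y → x * y ≈ 0ℤ [ + p ] → x ≈ 0ℤ [ + p ] ⊎ y ≈ 0ℤ [ + p ]
  ≈0-split x y h with euclidsLemma ∣ x ∣ ∣ y ∣ pr
                        (subst (p ℕ.∣_) (ℤ.abs-* x y) (≈0⇒∣ {a = x * y} h))
  ... | inj₁ d = inj₁ (∣⇒≈0 d)
  ... | inj₂ d = inj₂ (∣⇒≈0 d)

  *-≉0 : ∀ {x y} → ¬ x ≈ 0ℤ [ + p ] → ¬ y ≈ 0ℤ [ + p ] → ¬ x * y ≈ 0ℤ [ + p ]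
  *-≉0 {x} {y} x≉0 y≉0 h with ≈0-split x y h
  ... | inj₁ x≈0 = x≉0 x≈0
  ... | inj₂ y≈0 = y≉0 y≈0

  -- The nonzero remainder of `x` is coprime to `p`. Bézout's identity comes with natural
  -- coefficients, so the inverse is `- + t` or `+ t` according to which of the two products is the
  -- larger.
  inverse : ∀ x → ¬ x ≈ 0ℤ [ + p ] → ∃ λ y → x * y ≈ 1ℤ [ + p ]
  inverse x x≉0 with x %ℕ p | n%ℕd<d x p | a≡a%ℕn+[a/ℕn]*n x p
  ... | zero  | _   | eq = contradiction (congruent (x /ℕ p) lemma) x≉0
    where
    lemma : x - 0ℤ ≡ + p * (x /ℕ p)
    lemma = trans (ℤ.+-identityʳ x) (trans eq (trans (ℤ.+-identityˡ _) (ℤ.*-comm (x /ℕ p) (+ p))))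
  ... | suc r | r<p | eq with coprime-Bézout (prime⇒coprime pr r<p)
  ...   | Bézout.+- s t e = - + t ,
    lemma (+ p) (+ suc r) (x /ℕ p) (+ s) (+ t) eq
      (trans (cong (λ z → 1ℤ + z) (sym (ℤ.pos-* t (suc r)))) (trans (cong +_ e) (ℤ.pos-* s p)))
    where
    lemma : ∀ m r u s t → x ≡ r + u * m → 1ℤ + t * r ≡ s * m → x * - t ≈ 1ℤ [ m ]
    lemma m r u s t refl e = congruent (- (u * t) - s) (begin
      (r + u * m) * - t - 1ℤ             ≡⟨ solve (r ∷ u ∷ m ∷ t ∷ []) ⟩
      m * - (u * t) - (1ℤ + t * r)       ≡⟨ cong (λ z → m * - (u * t) - z) e ⟩
      m * - (u * t) - s * m              ≡⟨ solve (u ∷ m ∷ t ∷ s ∷ []) ⟩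
      m * (- (u * t) - s)                ∎)
      where open ≡-Reasoning
  ...   | Bézout.-+ s t e = + t ,
    lemma (+ p) (+ suc r) (x /ℕ p) (+ s) (+ t) eq
      (trans (cong (λ z → 1ℤ + z) (sym (ℤ.pos-* s p))) (trans (cong +_ e) (ℤ.pos-* t (suc r))))
    where
    lemma : ∀ m r u s t → x ≡ r + u * m → 1ℤ + s * m ≡ t * r → x * t ≈ 1ℤ [ m ]
    lemma m r u s t refl e = congruent (u * t + s) (begin
      (r + u * m) * t - 1ℤ               ≡⟨ solve (r ∷ u ∷ m ∷ t ∷ []) ⟩
      m * (u * t) + t * r - 1ℤ           ≡⟨ cong (λ z → m * (u * t) + z - 1ℤ) e ⟨
      m * (u * t) + (1ℤ + s * m) - 1ℤ    ≡⟨ solve (u ∷ m ∷ t ∷ s ∷ []) ⟩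
      m * (u * t + s)                    ∎)
      where open ≡-Reasoning

-- Sums over ℤ/nℤ

open Sum ℕ.+-*-semiring using (sum; sum-cong-≗; ∑-distrib-+; ∑-comm; *-distribˡ-sum; sum-permute)

-- The summand is a function on ℤ, so that changes of variable are plain integer expressions;
-- independence of the representative is asked for, as `Periodic`, only where it is used.
∑ : ℕ → (ℤ → ℕ) → ℕ
∑ n f = sum {n} (f ∘ rep)

infix 5 ⟦_⟧

⟦_⟧ : ∀ {P : Set} → Dec P → ℕ
⟦ yes _ ⟧ = 1
⟦ no  _ ⟧ = 0

⟦⟧-yes : ∀ {P : Set} (P? : Dec P) → P → ⟦ P? ⟧ ≡ 1
⟦⟧-yes (yes _) _ = refl
⟦⟧-yes (no ¬p) p = contradiction p ¬p

⟦⟧-no : ∀ {P : Set} (P? : Dec P) → ¬ P → ⟦ P? ⟧ ≡ 0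
⟦⟧-no (yes p) ¬p = contradiction p ¬p
⟦⟧-no (no _)  _  = refl

⟦⟧-cong : ∀ {P Q : Set} (P? : Dec P) (Q? : Dec Q) → (P → Q) → (Q → P) → ⟦ P? ⟧ ≡ ⟦ Q? ⟧
⟦⟧-cong (yes p) Q? f _ = sym (⟦⟧-yes Q? (f p))
⟦⟧-cong (no ¬p) Q? _ g = sym (⟦⟧-no Q? (¬p ∘ g))

⟦⟧-mono : ∀ {P Q : Set} (P? : Dec P) (Q? : Dec Q) → (P → Q) → ⟦ P? ⟧ ≤ ⟦ Q? ⟧
⟦⟧-mono (yes p) Q? f = ℕ.≤-reflexive (sym (⟦⟧-yes Q? (f p)))
⟦⟧-mono (no _)  Q? f = ℕ.z≤n

∑-cong : ∀ n {f g} → (∀ x → f x ≡ g x) → ∑ n f ≡ ∑ n g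
∑-cong n f≗g = sum-cong-≗ {n} (λ i → f≗g (rep i))

∑-+ : ∀ n f g → ∑ n (λ x → f x ℕ.+ g x) ≡ ∑ n f ℕ.+ ∑ n g
∑-+ n f g = ∑-distrib-+ {n} (f ∘ rep) (g ∘ rep)

∑-swap : ∀ m n (f : ℤ → ℤ → ℕ) →
         ∑ m (λ x → ∑ n (λ y → f x y)) ≡ ∑ n (λ y → ∑ m (λ x → f x y))
∑-swap m n f = ∑-comm {m} {n} (λ i j → f (rep i) (rep j))

∑-*ˡ : ∀ n c f → ∑ n (λ x → c ℕ.* f x) ≡ c ℕ.* ∑ n f
∑-*ˡ n c f = sym (*-distribˡ-sum {n} c (f ∘ rep))

∑-const : ∀ n {f} c → (∀ x → f x ≡ c) → ∑ n f ≡ n ℕ.* c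
∑-const zero    c h = refl
-- `rep (suc i)` reduces to `1ℤ + rep i`, so the tail of a sum is the sum of the shifted function.
∑-const (suc n) c h = cong₂ ℕ._+_ (h 0ℤ) (∑-const n c (λ x → h (1ℤ + x)))

∑-zero : ∀ n {f} → (∀ x → f x ≡ 0) → ∑ n f ≡ 0
∑-zero n h = trans (∑-const n 0 h) (ℕ.*-zeroʳ n)

∑-mono : ∀ n {f g} → (∀ x → f x ≤ g x) → ∑ n f ≤ ∑ n g
∑-mono zero    h = ℕ.z≤n
∑-mono (suc n) h = ℕ.+-mono-≤ (h 0ℤ) (∑-mono n (λ x → h (1ℤ + x)))

∑-++ : ∀ m n f → ∑ (m ℕ.+ n) f ≡ ∑ m f ℕ.+ ∑ n (λ x → f (+ m + x))
∑-++ zero    n f = ∑-cong n λ x → cong f (sym (ℤ.+-identityˡ x))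
∑-++ (suc m) n f = begin
  f 0ℤ ℕ.+ ∑ (m ℕ.+ n) f′                                ≡⟨ cong (f 0ℤ ℕ.+_) (∑-++ m n f′) ⟩
  f 0ℤ ℕ.+ (∑ m f′ ℕ.+ ∑ n (λ x → f (1ℤ + (+ m + x))))   ≡⟨ ℕ.+-assoc (f 0ℤ) _ _ ⟨
  ∑ (suc m) f ℕ.+ ∑ n (λ x → f (1ℤ + (+ m + x)))
    ≡⟨ cong (∑ (suc m) f ℕ.+_) (∑-cong n λ x → cong f (sym (ℤ.+-assoc 1ℤ (+ m) x))) ⟩
  ∑ (suc m) f ℕ.+ ∑ n (λ x → f (+ suc m + x))            ∎
  where
  open ≡-Reasoning
  f′ = λ x → f (1ℤ + x)

∑-blocks : ∀ m n f → ∑ (m ℕ.* n) f ≡ ∑ m (λ x → ∑ n (λ y → f (+ n * x + y)))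
∑-blocks zero    n f = refl
∑-blocks (suc m) n f = begin
  ∑ (n ℕ.+ m ℕ.* n) f                              ≡⟨ ∑-++ n (m ℕ.* n) f ⟩
  ∑ n f ℕ.+ ∑ (m ℕ.* n) (λ z → f (+ n + z))        ≡⟨ cong (∑ n f ℕ.+_) (∑-blocks m n (λ z → f (+ n + z))) ⟩
  ∑ n f ℕ.+ ∑ m (λ x → ∑ n (λ y → f (+ n + (+ n * x + y))))
    ≡⟨ cong₂ ℕ._+_ (∑-cong n λ y → cong f (at-0 (+ n) y))
         (∑-cong m λ x → ∑-cong n λ y → cong f (at-suc (+ n) x y)) ⟩
  ∑ (suc m) (λ x → ∑ n (λ y → f (+ n * x + y)))    ∎
  where
  open ≡-Reasoning
  at-0 : ∀ n y → y ≡ n * 0ℤ + y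
  at-0 n y = solve (n ∷ y ∷ [])
  at-suc : ∀ n x y → n + (n * x + y) ≡ n * (1ℤ + x) + y
  at-suc n x y = solve (n ∷ x ∷ y ∷ [])

Periodic : ℤ → (ℤ → ℕ) → Set
Periodic n f = ∀ {x y} → x ≈ y [ n ] → f x ≡ f y

∑-periodic : ∀ m n f → Periodic (+ n) f → ∑ (m ℕ.* n) f ≡ m ℕ.* ∑ n f
∑-periodic m n f per = trans (∑-blocks m n f)
  (∑-const m (∑ n f) λ x → ∑-cong n λ y → per (shift (+ n) x y))
  where
  shift : ∀ n x y → n * x + y ≈ y [ n ]
  shift n x y = congruent x (solve (n ∷ x ∷ y ∷ []))

∑-punctured : ∀ n {f} c → (∀ x → ¬ x ≈ 0ℤ [ + suc n ] → f x ≡ c) →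
              ∑ (suc n) f ≡ f 0ℤ ℕ.+ n ℕ.* c
∑-punctured n {f} c h = cong (f 0ℤ ℕ.+_)
  (trans (sum-cong-≗ constant) (∑-const n c (λ _ → refl)))
  where
  constant : ∀ (i : Fin n) → f (rep (suc i)) ≡ c
  constant i = h (rep (suc i)) λ e → case rep-injective {suc n} {suc i} {zero} e of λ ()

∑-concentrated : ∀ n .{{_ : NonZero n}} {f} → (∀ x → ¬ x ≈ 0ℤ [ + n ] → f x ≡ 0) → ∑ n f ≡ f 0ℤ
∑-concentrated (suc n) {f} h = trans (∑-punctured n 0 h)
  (trans (cong (f 0ℤ ℕ.+_) (ℕ.*-zeroʳ n)) (ℕ.+-identityʳ _))

-- In each block of `n` consecutive integers only the multiple of `n` contributes.
∑-multiples : ∀ m n .{{_ : NonZero n}} {f} → (∀ x → ¬ x ≈ 0ℤ [ + n ] → f x ≡ 0) →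
              ∑ (n ℕ.* m) f ≡ ∑ m (λ x → f (+ n * x))
∑-multiples m n {f} h = begin
  ∑ (n ℕ.* m) f                              ≡⟨ cong (λ k → ∑ k f) (ℕ.*-comm n m) ⟩
  ∑ (m ℕ.* n) f                              ≡⟨ ∑-blocks m n f ⟩
  ∑ m (λ x → ∑ n (λ y → f (+ n * x + y)))
    ≡⟨ ∑-cong m (λ x → ∑-concentrated n λ y y≉0 → h _ λ e → y≉0 (≈-trans (shift (+ n) x y) e)) ⟩
  ∑ m (λ x → f (+ n * x + 0ℤ))
    ≡⟨ ∑-cong m (λ x → cong f (ℤ.+-identityʳ (+ n * x))) ⟩
  ∑ m (λ x → f (+ n * x))                    ∎
  where
  open ≡-Reasoning
  shift : ∀ n x y → y ≈ n * x + y [ n ]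
  shift n x y = congruent (- x) (solve (n ∷ x ∷ y ∷ []))

∑-reindex : ∀ n .{{_ : NonZero n}} f → Periodic (+ n) f → (g h : ℤ → ℤ) →
            (∀ {x y} → x ≈ y [ + n ] → g x ≈ g y [ + n ]) →
            (∀ {x y} → x ≈ y [ + n ] → h x ≈ h y [ + n ]) →
            (∀ x → g (h x) ≈ x [ + n ]) → (∀ x → h (g x) ≈ x [ + n ]) →
            ∑ n (f ∘ g) ≡ ∑ n f
∑-reindex n f per g h g-cong h-cong gh hg = begin
  ∑ n (f ∘ g)
    ≡⟨ sum-cong-≗ {n} (λ i → per (≈-sym (rep-residue n (g (rep i))))) ⟩
  sum {n} (f ∘ rep ∘ g′)
    ≡⟨ sum-permute (f ∘ rep) (permutation g′ h′
         (λ i → rep-injective (inverse-on g h g-cong gh i))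
         (λ i → rep-injective (inverse-on h g h-cong hg i))) ⟨
  ∑ n f ∎
  where
  open ≡-Reasoning
  g′ h′ : Fin n → Fin n
  g′ i = residue n (g (rep i))
  h′ i = residue n (h (rep i))
  inverse-on : (g h : ℤ → ℤ) → (∀ {x y} → x ≈ y [ + n ] → g x ≈ g y [ + n ]) →
               (∀ x → g (h x) ≈ x [ + n ]) → (i : Fin n) →
               rep (residue n (g (rep (residue n (h (rep i)))))) ≈ rep i [ + n ]
  inverse-on g h g-cong gh i = ≈-trans (rep-residue n _)
    (≈-trans (g-cong (rep-residue n (h (rep i)))) (gh (rep i)))

∑-affine : ∀ n .{{_ : NonZero n}} f → Periodic (+ n) f → ∀ c {e e′} → e * e′ ≈ 1ℤ [ + n ] →
           ∑ n (λ x → f (c + e * x)) ≡ ∑ n f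
∑-affine n f per c {e} {e′} ee′ = ∑-reindex n f per (λ x → c + e * x) (λ x → e′ * (x - c))
  (λ {x} {y} h → lin₁ e h (solve (c ∷ e ∷ x ∷ y ∷ [])))
  (λ {x} {y} h → lin₁ e′ h (solve (c ∷ e′ ∷ x ∷ y ∷ [])))
  (λ x → lin₁ (x - c) ee′ (solve (c ∷ e ∷ e′ ∷ x ∷ [])))
  (λ x → lin₁ x ee′ (solve (c ∷ e ∷ e′ ∷ x ∷ [])))

∑-translate : ∀ n .{{_ : NonZero n}} f → Periodic (+ n) f → ∀ c →
              ∑ n (λ x → f (c + x)) ≡ ∑ n f
∑-translate n f per c = trans
  (∑-cong n λ x → cong (λ y → f (c + y)) (sym (ℤ.*-identityˡ x)))
  (∑-affine n f per c {1ℤ} {1ℤ} ≈-refl)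

∑-point : ∀ n .{{_ : NonZero n}} c → ∑ n (λ x → ⟦ x ≈? c [ + n ] ⟧) ≡ 1
∑-point n c = begin
  ∑ n (λ x → ⟦ x ≈? c [ + n ] ⟧)
    ≡⟨ ∑-translate n (λ x → ⟦ x ≈? c [ + n ] ⟧) (λ {x} {y} e → ⟦⟧-cong (x ≈? c [ + n ]) (y ≈? c [ + n ])
                        (≈-trans (≈-sym e)) (≈-trans e)) c ⟨
  ∑ n (λ x → ⟦ c + x ≈? c [ + n ] ⟧)
    ≡⟨ ∑-concentrated n (λ x x≉0 → ⟦⟧-no (c + x ≈? c [ + n ])
         λ e → x≉0 (lin₁ 1ℤ e (solve (c ∷ x ∷ [])))) ⟩
  ⟦ c + 0ℤ ≈? c [ + n ] ⟧
    ≡⟨ ⟦⟧-yes (c + 0ℤ ≈? c [ + n ]) (≈-reflexive (ℤ.+-identityʳ c)) ⟩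
  1 ∎
  where open ≡-Reasoning

∑-linear : ∀ n .{{_ : NonZero n}} e → (∃ λ e′ → e * e′ ≈ 1ℤ [ + n ]) → ∀ c →
           ∑ n (λ x → ⟦ e * x ≈? c [ + n ] ⟧) ≡ 1
∑-linear n e (e′ , ee′) c = trans
  (∑-cong n λ x → ⟦⟧-cong (e * x ≈? c [ + n ]) (x ≈? e′ * c [ + n ])
    (λ h → lin₂ e′ (- x) h ee′ (solve (e ∷ e′ ∷ x ∷ c ∷ [])))
    (λ h → lin₂ e c h ee′ (solve (e ∷ e′ ∷ x ∷ c ∷ []))))
  (∑-point n (e′ * c))

-- As the tail cannot exceed `n * c`, the head has to supply all of `c`. This turns a bound and a
-- total into an exact count for every residue.
∑-saturated : ∀ n {f} c → (∀ x → f x ≤ c) → ∑ n f ≡ n ℕ.* c → (i : Fin n) → f (rep i) ≡ c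
∑-saturated (suc n) {f} c h eq i = saturated i
  where
  tail≤ : ∑ n (λ x → f (1ℤ + x)) ≤ n ℕ.* c
  tail≤ = ℕ.≤-trans (∑-mono n (λ x → h (1ℤ + x))) (ℕ.≤-reflexive (∑-const n c λ _ → refl))
  head≡ : f 0ℤ ≡ c
  head≡ = ℕ.≤-antisym (h 0ℤ) (ℕ.+-cancelʳ-≤ (n ℕ.* c) c (f 0ℤ)
    (ℕ.≤-trans (ℕ.≤-reflexive (sym eq)) (ℕ.+-monoʳ-≤ (f 0ℤ) tail≤)))
  saturated : ∀ i → f (rep i) ≡ c
  saturated zero    = head≡
  saturated (suc i) = ∑-saturated n c (λ x → h (1ℤ + x))
    (ℕ.+-cancelˡ-≡ c _ _ (trans (cong (ℕ._+ _) (sym head≡)) eq)) i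

-- Conics modulo an odd prime

Conic : ℤ → ℤ → ℤ → ℤ → ℤ → Set
Conic n a δ u y = y * y ≈ δ + u * u * a [ n ]

Origin : ℤ → ℤ → ℤ → Set
Origin n u y = u ≈ 0ℤ [ n ] × y ≈ 0ℤ [ n ]

origin? : ∀ n u y → Dec (Origin n u y)
origin? n u y = (u ≈? 0ℤ [ n ]) ×-dec (y ≈? 0ℤ [ n ])

Origin-resp : ∀ {n u u′ y y′} → u ≈ u′ [ n ] → y ≈ y′ [ n ] → Origin n u y → Origin n u′ y′
Origin-resp e e′ (h , h′) = ≈-trans (≈-sym e) h , ≈-trans (≈-sym e′) h′

-- For an odd prime `n` not dividing `a`, the origin is the only possible singular point, and it
-- lies on the conic exactly when `n` divides `δ`.
SmoothConic : ℤ → ℤ → ℤ → ℤ → ℤ → Set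
SmoothConic n a δ u y = Conic n a δ u y × ¬ Origin n u y

smoothConic? : ∀ n a δ u y → Dec (SmoothConic n a δ u y)
smoothConic? n a δ u y = (y * y ≈? δ + u * u * a [ n ]) ×-dec ¬? (origin? n u y)

SmoothConic-resp : ∀ {n} a δ {u u′ y y′} → u ≈ u′ [ n ] → y ≈ y′ [ n ] →
                   SmoothConic n a δ u y → SmoothConic n a δ u′ y′
SmoothConic-resp a δ {u} {u′} {y} {y′} e e′ (h , ¬o) =
  lin₃ 1ℤ ((u + u′) * a) (- (y + y′)) h e e′ (solve (a ∷ δ ∷ u ∷ u′ ∷ y ∷ y′ ∷ [])) ,
  ¬o ∘ Origin-resp (≈-sym e) (≈-sym e′)

smoothCount : ℕ → ℤ → ℤ → ℕ
smoothCount n a δ = ∑ n λ u → ∑ n λ y → ⟦ smoothConic? (+ n) a δ u y ⟧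

module OddPrime (q : ℕ) (pr : Prime (suc q)) (2≉0 : ¬ + 2 ≈ 0ℤ [ + suc q ]) where

  private
    p = suc q
    𝕡 = + p

  inverseʳ≉0 : ∀ {x y} → x * y ≈ 1ℤ [ 𝕡 ] → ¬ y ≈ 0ℤ [ 𝕡 ]
  inverseʳ≉0 {x} {y} xy y≈0 = 2≉0 (lin₂ (- + 2) (+ 2 * x) xy y≈0 (solve (x ∷ y ∷ [])))

  square≈0 : ∀ y → y * y ≈ 0ℤ [ 𝕡 ] → y ≈ 0ℤ [ 𝕡 ]
  square≈0 y h with ≈0-split pr y y h
  ... | inj₁ e = e
  ... | inj₂ e = e

  smoothHyperbola? : ∀ δ r s → Dec (r * s ≈ δ [ 𝕡 ] × ¬ Origin 𝕡 r s)
  smoothHyperbola? δ r s = (r * s ≈? δ [ 𝕡 ]) ×-dec ¬? (origin? 𝕡 r s)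

  -- Each of the `q` rows `r ≉ 0` contains exactly one `s`. The row `r ≈ 0` is empty unless `δ ≈ 0`,
  -- and then it consists of the `q` nonzero values of `s`.
  hyperbola-count : ∀ δ → ∑ p (λ r → ∑ p λ s → ⟦ smoothHyperbola? δ r s ⟧) ≡
                          q ℕ.* ⟦ δ ≈? 0ℤ [ 𝕡 ] ⟧ ℕ.+ q
  hyperbola-count δ = begin
    ∑ p (λ r → ∑ p λ s → ⟦ smoothHyperbola? δ r s ⟧)
      ≡⟨ ∑-punctured q 1 (λ r r≉0 → trans (∑-cong p λ s → ⟦⟧-cong (smoothHyperbola? δ r s) (r * s ≈? δ [ 𝕡 ])
                    proj₁ (λ h → h , r≉0 ∘ proj₁))
                 (∑-linear p r (inverse pr r r≉0) δ)) ⟩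
    ∑ p (λ s → ⟦ smoothHyperbola? δ 0ℤ s ⟧) ℕ.+ q ℕ.* 1
      ≡⟨ cong₂ ℕ._+_ (∑-punctured q ⟦ δ ≈? 0ℤ [ 𝕡 ] ⟧ λ s s≉0 →
             ⟦⟧-cong (smoothHyperbola? δ 0ℤ s) (δ ≈? 0ℤ [ 𝕡 ])
               (λ (h , _) → ≈-sym h) (λ h → ≈-sym h , s≉0 ∘ proj₂))
           (ℕ.*-identityʳ q) ⟩
    ⟦ smoothHyperbola? δ 0ℤ 0ℤ ⟧ ℕ.+ q ℕ.* ⟦ δ ≈? 0ℤ [ 𝕡 ] ⟧ ℕ.+ q
      ≡⟨ cong (λ n → n ℕ.+ q ℕ.* ⟦ δ ≈? 0ℤ [ 𝕡 ] ⟧ ℕ.+ q)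
           (⟦⟧-no (smoothHyperbola? δ 0ℤ 0ℤ) λ (_ , ¬o) → ¬o (≈-refl , ≈-refl)) ⟩
    q ℕ.* ⟦ δ ≈? 0ℤ [ 𝕡 ] ⟧ ℕ.+ q ∎
    where open ≡-Reasoning

  -- y² − g²u² = (y − gu)(y + gu): new coordinates r = y − gu and s = y + gu.
  square-count : ∀ {a} g → g * g ≈ a [ 𝕡 ] → ¬ a ≈ 0ℤ [ 𝕡 ] → ∀ δ →
                 smoothCount p a δ ≡ q ℕ.* ⟦ δ ≈? 0ℤ [ 𝕡 ] ⟧ ℕ.+ q
  square-count {a} g g²≈a a≉0 δ = begin
    ∑ p (λ u → ∑ p λ y → F u y)
      ≡⟨ ∑-cong p (λ u → ∑-translate p (F u) (λ e → F-cong (≈-refl {a = u}) e) (g * u)) ⟨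
    ∑ p (λ u → ∑ p λ r → F u (g * u + r))
      ≡⟨ ∑-swap p p (λ u r → F u (g * u + r)) ⟩
    ∑ p (λ r → ∑ p λ u → F u (g * u + r))
      -- Here `h` inverts 2g: solving s = y + gu = r + 2gu for u gives u = h(s - r).
      ≡⟨ ∑-cong p (λ r → ∑-affine p (λ u → F u (g * u + r))
           (λ {u} {u′} e → F-cong e (lin₁ g e (solve (g ∷ u ∷ u′ ∷ r ∷ []))))
           (- (h * r)) {h} {+ 2 * g} h-inv) ⟨
    ∑ p (λ r → ∑ p λ s → F (U r s) (g * U r s + r))
      ≡⟨ ∑-cong p (λ r → ∑-cong p λ s →
           ⟦⟧-cong (smoothConic? 𝕡 a δ (U r s) (g * U r s + r)) (smoothHyperbola? δ r s)
             (λ (c , ¬o) → to r s c , ¬o ∘ to-origin r s)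
             (λ (c , ¬o) → from r s c , ¬o ∘ from-origin r s)) ⟩
    ∑ p (λ r → ∑ p λ s → ⟦ smoothHyperbola? δ r s ⟧)
      ≡⟨ hyperbola-count δ ⟩
    q ℕ.* ⟦ δ ≈? 0ℤ [ 𝕡 ] ⟧ ℕ.+ q ∎
    where
    open ≡-Reasoning
    F : ℤ → ℤ → ℕ
    F u y = ⟦ smoothConic? 𝕡 a δ u y ⟧
    F-cong : ∀ {u u′ y y′} → u ≈ u′ [ 𝕡 ] → y ≈ y′ [ 𝕡 ] → F u y ≡ F u′ y′
    F-cong {u} {u′} {y} {y′} e e′ = ⟦⟧-cong (smoothConic? 𝕡 a δ u y) (smoothConic? 𝕡 a δ u′ y′)
      (SmoothConic-resp a δ e e′) (SmoothConic-resp a δ (≈-sym e) (≈-sym e′))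
    g≉0 : ¬ g ≈ 0ℤ [ 𝕡 ]
    g≉0 g≈0 = a≉0 (lin₂ g -1ℤ g≈0 g²≈a (solve (g ∷ a ∷ [])))
    2g-inv = inverse pr (+ 2 * g) (*-≉0 pr 2≉0 g≉0)
    h = proj₁ 2g-inv
    h-inv : h * (+ 2 * g) ≈ 1ℤ [ 𝕡 ]
    h-inv = subst (_≈ 1ℤ [ 𝕡 ]) (ℤ.*-comm (+ 2 * g) h) (proj₂ 2g-inv)
    U : ℤ → ℤ → ℤ
    U r s = - (h * r) + h * s
    to : ∀ r s → Conic 𝕡 a δ (U r s) (g * U r s + r) → r * s ≈ δ [ 𝕡 ]
    -- The ring solver works with variables, so `h`, a projection from `inverse`, is generalised
    -- first. Local lemmas elsewhere abstract the prime, the modulus or a module parameter for the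
    -- same purpose.
    to r s c = to′ h c h-inv
      where
      to′ : ∀ h → Conic 𝕡 a δ (- (h * r) + h * s) (g * (- (h * r) + h * s) + r) →
            h * (+ 2 * g) ≈ 1ℤ [ 𝕡 ] → r * s ≈ δ [ 𝕡 ]
      to′ h c hh = lin₃ 1ℤ (- ((- (h * r) + h * s) * (- (h * r) + h * s))) (- (r * (s - r))) c g²≈a hh
        (solve (h ∷ g ∷ r ∷ s ∷ a ∷ δ ∷ []))
    from : ∀ r s → r * s ≈ δ [ 𝕡 ] → Conic 𝕡 a δ (U r s) (g * U r s + r)
    from r s c = from′ h h-inv
      where
      from′ : ∀ h → h * (+ 2 * g) ≈ 1ℤ [ 𝕡 ] →
              Conic 𝕡 a δ (- (h * r) + h * s) (g * (- (h * r) + h * s) + r)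
      from′ h hh = lin₃ 1ℤ ((- (h * r) + h * s) * (- (h * r) + h * s)) (r * (s - r)) c g²≈a hh
        (solve (h ∷ g ∷ r ∷ s ∷ a ∷ δ ∷ []))
    to-origin : ∀ r s → Origin 𝕡 r s → Origin 𝕡 (U r s) (g * U r s + r)
    to-origin r s (r≈0 , s≈0) = u≈0 h , y≈0 h
      where
      u≈0 : ∀ h → - (h * r) + h * s ≈ 0ℤ [ 𝕡 ]
      u≈0 h = lin₂ (- h) h r≈0 s≈0 (solve (h ∷ r ∷ s ∷ []))
      y≈0 : ∀ h → g * (- (h * r) + h * s) + r ≈ 0ℤ [ 𝕡 ]
      y≈0 h = lin₂ (1ℤ - g * h) (g * h) r≈0 s≈0 (solve (g ∷ h ∷ r ∷ s ∷ []))
    from-origin : ∀ r s → Origin 𝕡 (U r s) (g * U r s + r) → Origin 𝕡 r s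
    from-origin r s (u≈0 , y≈0) = r≈0 h u≈0 y≈0 , s≈0 h u≈0 y≈0 h-inv
      where
      r≈0 : ∀ h → - (h * r) + h * s ≈ 0ℤ [ 𝕡 ] → g * (- (h * r) + h * s) + r ≈ 0ℤ [ 𝕡 ] →
            r ≈ 0ℤ [ 𝕡 ]
      r≈0 h u≈0 y≈0 = lin₂ 1ℤ (- g) y≈0 u≈0 (solve (g ∷ h ∷ r ∷ s ∷ []))
      s≈0 : ∀ h → - (h * r) + h * s ≈ 0ℤ [ 𝕡 ] → g * (- (h * r) + h * s) + r ≈ 0ℤ [ 𝕡 ] →
            h * (+ 2 * g) ≈ 1ℤ [ 𝕡 ] → s ≈ 0ℤ [ 𝕡 ]
      s≈0 h u≈0 y≈0 hh = lin₃ 1ℤ g (- (s - r)) y≈0 u≈0 hh (solve (g ∷ h ∷ r ∷ s ∷ []))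

  root? : ∀ e v → Dec (∃ λ y → e * (y * y) ≈ v [ 𝕡 ])
  root? e v = map′ (λ (i , h) → rep i , h)
    (λ (y , h) → residue p y , lemma (rep-residue p y) h)
    (any? λ (i : Fin p) → e * (rep i * rep i) ≈? v [ 𝕡 ])
    where
    lemma : ∀ {y y′} → y′ ≈ y [ 𝕡 ] → e * (y * y) ≈ v [ 𝕡 ] → e * (y′ * y′) ≈ v [ 𝕡 ]
    lemma {y} {y′} r h = lin₂ (e * (y′ + y)) 1ℤ r h (solve (e ∷ v ∷ y ∷ y′ ∷ []))

  -- Used with `e` equal to 1 and to a nonsquare: between them the values of the two forms e·y²
  -- exhaust all residues.
  rootCount : ℤ → ℤ → ℕ
  rootCount e v = ∑ p λ y → ⟦ e * (y * y) ≈? v [ 𝕡 ] ⟧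

  -- Subtracting the two equations gives e(y - z)(y + z) ≈ 0, so every root is z or -z.
  rootCount-root : ∀ {e} → ¬ e ≈ 0ℤ [ 𝕡 ] → ∀ v z → e * (z * z) ≈ v [ 𝕡 ] → rootCount e v ≤ 2
  rootCount-root {e} e≉0 v z hz = ℕ.≤-trans (∑-mono p bound) (ℕ.≤-reflexive
    (trans (∑-+ p (λ y → ⟦ y ≈? z [ 𝕡 ] ⟧) (λ y → ⟦ y ≈? - z [ 𝕡 ] ⟧))
           (cong₂ ℕ._+_ (∑-point p z) (∑-point p (- z)))))
    where
    z-or-−z : ∀ y → e * (y * y) ≈ v [ 𝕡 ] → y - z ≈ 0ℤ [ 𝕡 ] ⊎ y + z ≈ 0ℤ [ 𝕡 ]
    z-or-−z y h with ≈0-split pr e ((y - z) * (y + z)) (lin₂ 1ℤ -1ℤ h hz (solve (e ∷ v ∷ y ∷ z ∷ [])))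
    ... | inj₁ e≈0 = contradiction e≈0 e≉0
    ... | inj₂ h′  = ≈0-split pr (y - z) (y + z) h′
    bound : ∀ y → ⟦ e * (y * y) ≈? v [ 𝕡 ] ⟧ ≤ ⟦ y ≈? z [ 𝕡 ] ⟧ ℕ.+ ⟦ y ≈? - z [ 𝕡 ] ⟧
    bound y with e * (y * y) ≈? v [ 𝕡 ]
    ... | no _ = ℕ.z≤n
    ... | yes h with z-or-−z y h
    ...   | inj₁ k = ℕ.m≤n⇒m≤n+o _ (ℕ.≤-reflexive (sym
              (⟦⟧-yes (y ≈? z [ 𝕡 ]) (lin₁ 1ℤ k (solve (y ∷ z ∷ []))))))
    ...   | inj₂ k = ℕ.m≤n⇒m≤o+n _ (ℕ.≤-reflexive (sym
              (⟦⟧-yes (y ≈? - z [ 𝕡 ]) (lin₁ 1ℤ k (solve (y ∷ z ∷ []))))))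

  rootCount≤2 : ∀ {e} → ¬ e ≈ 0ℤ [ 𝕡 ] → ∀ v → rootCount e v ≤ 2
  rootCount≤2 {e} e≉0 v with root? e v
  ... | yes (z , hz) = rootCount-root e≉0 v z hz
  ... | no none = ℕ.≤-trans (ℕ.≤-reflexive
          (∑-zero p λ y → ⟦⟧-no (e * (y * y) ≈? v [ 𝕡 ]) λ h → none (y , h)))
        ℕ.z≤n

  -- Double counting: each `y` is a root for exactly one `v`.
  rootCount-total : ∀ e → ∑ p (rootCount e) ≡ p
  rootCount-total e = begin
    ∑ p (λ v → ∑ p λ y → ⟦ e * (y * y) ≈? v [ 𝕡 ] ⟧)
      ≡⟨ ∑-swap p p (λ v y → ⟦ e * (y * y) ≈? v [ 𝕡 ] ⟧) ⟩
    ∑ p (λ y → ∑ p λ v → ⟦ e * (y * y) ≈? v [ 𝕡 ] ⟧)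
      ≡⟨ ∑-const p 1 (λ y → trans
           (∑-cong p λ v → ⟦⟧-cong (e * (y * y) ≈? v [ 𝕡 ]) (v ≈? e * (y * y) [ 𝕡 ]) ≈-sym ≈-sym)
           (∑-point p (e * (y * y)))) ⟩
    p ℕ.* 1 ≡⟨ ℕ.*-identityʳ p ⟩
    p       ∎
    where open ≡-Reasoning

  rootCount-zero : ∀ {e v} → ¬ e ≈ 0ℤ [ 𝕡 ] → v ≈ 0ℤ [ 𝕡 ] → rootCount e v ≤ 1
  rootCount-zero {e} {v} e≉0 v≈0 = ℕ.≤-trans (∑-mono p λ y →
    ⟦⟧-mono (e * (y * y) ≈? v [ 𝕡 ]) (y ≈? 0ℤ [ 𝕡 ]) (y≈0 y))
    (ℕ.≤-reflexive (∑-point p 0ℤ))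
    where
    y≈0 : ∀ y → e * (y * y) ≈ v [ 𝕡 ] → y ≈ 0ℤ [ 𝕡 ]
    y≈0 y h with ≈0-split pr e (y * y) (≈-trans h v≈0)
    ... | inj₁ e≈0 = contradiction e≈0 e≉0
    ... | inj₂ h′  = square≈0 y h′

  module NonSquare (a : ℤ) (nonsquare : ∀ g → ¬ g * g ≈ a [ 𝕡 ]) where

    a≉0 : ¬ a ≈ 0ℤ [ 𝕡 ]
    a≉0 h = nonsquare 0ℤ (≈-sym h)

    1≉0 : ¬ 1ℤ ≈ 0ℤ [ 𝕡 ]
    1≉0 h = 2≉0 (lin₁ (+ 2) h refl)

    -- Otherwise y/x would be a square root of `a`.
    quotient-square : ∀ {x y} → ¬ x ≈ 0ℤ [ 𝕡 ] → ¬ y * y ≈ a * (x * x) [ 𝕡 ]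
    quotient-square {x} {y} x≉0 h =
      nonsquare (y * proj₁ (inverse pr x x≉0)) (square _ (proj₂ (inverse pr x x≉0)))
      where
      square : ∀ x′ → x * x′ ≈ 1ℤ [ 𝕡 ] → (y * x′) * (y * x′) ≈ a [ 𝕡 ]
      square x′ xx′ = lin₂ (x′ * x′) (a * (x * x′ + 1ℤ)) h xx′ (solve (a ∷ x ∷ x′ ∷ y ∷ []))

    smoothCount-zero : ∀ {δ} → δ ≈ 0ℤ [ 𝕡 ] → smoothCount p a δ ≡ 0
    smoothCount-zero {δ} δ≈0 = ∑-zero p λ u → ∑-zero p λ y →
      ⟦⟧-no (smoothConic? 𝕡 a δ u y) λ (h , ¬o) → impossible u y h ¬o (u ≈? 0ℤ [ 𝕡 ])
      where
      impossible : ∀ u y → Conic 𝕡 a δ u y → ¬ Origin 𝕡 u y → ¬ Dec (u ≈ 0ℤ [ 𝕡 ])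
      impossible u y h ¬o (no u≉0) = quotient-square {u} {y} u≉0 (lin₂ 1ℤ 1ℤ h δ≈0 (solve (a ∷ δ ∷ u ∷ y ∷ [])))
      impossible u y h ¬o (yes u≈0) = ¬o (u≈0 , square≈0 y
        (lin₃ 1ℤ 1ℤ (u * a) h δ≈0 u≈0 (solve (a ∷ δ ∷ u ∷ y ∷ []))))

    -- If `v ≉ 0`, then y² = v and ax² = v cannot both be solvable, since their quotient would make
    -- `a` a square. If `v ≈ 0`, each equation has at most the root 0.
    rootCounts≤2 : ∀ v → rootCount 1ℤ v ℕ.+ rootCount a v ≤ 2
    rootCounts≤2 v with v ≈? 0ℤ [ 𝕡 ]
    ... | yes v≈0 = ℕ.+-mono-≤ (rootCount-zero 1≉0 v≈0) (rootCount-zero a≉0 v≈0)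
    ... | no v≉0 with root? a v
    ...   | yes (x , hx) = ℕ.+-mono-≤ (ℕ.≤-reflexive (∑-zero p λ y →
              ⟦⟧-no (1ℤ * (y * y) ≈? v [ 𝕡 ]) (exclusive x y v≉0 hx)))
            (rootCount≤2 a≉0 v)
      where
      exclusive : ∀ x y → ¬ v ≈ 0ℤ [ 𝕡 ] → a * (x * x) ≈ v [ 𝕡 ] → ¬ 1ℤ * (y * y) ≈ v [ 𝕡 ]
      exclusive x y v≉0 hx hy = quotient-square {x} {y}
        (λ x≈0 → v≉0 (lin₂ -1ℤ (a * x) hx x≈0 (solve (a ∷ v ∷ x ∷ []))))
        (lin₂ 1ℤ -1ℤ hy hx (solve (a ∷ v ∷ x ∷ y ∷ [])))
    ...   | no none = ℕ.+-mono-≤ (rootCount≤2 1≉0 v) (ℕ.≤-reflexive (∑-zero p λ y →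
              ⟦⟧-no (a * (y * y) ≈? v [ 𝕡 ]) λ h → none (y , h)))

    -- The two totals add up to 2p, so the bound 2 is attained at every residue. This takes the
    -- place of counting the squares modulo p.
    rootCounts≡2 : ∀ v → rootCount 1ℤ v ℕ.+ rootCount a v ≡ 2
    rootCounts≡2 v = trans
      (cong₂ ℕ._+_ (rootCount-cong 1ℤ (≈-sym (rep-residue p v))) (rootCount-cong a (≈-sym (rep-residue p v))))
      (∑-saturated p 2 rootCounts≤2 total (residue p v))
      where
      rootCount-cong : ∀ e {v v′} → v ≈ v′ [ 𝕡 ] → rootCount e v ≡ rootCount e v′
      rootCount-cong e {v} {v′} h = ∑-cong p λ y →
        ⟦⟧-cong (e * (y * y) ≈? v [ 𝕡 ]) (e * (y * y) ≈? v′ [ 𝕡 ])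
          (λ k → ≈-trans k h) (λ k → ≈-trans k (≈-sym h))
      total : ∑ p (λ v → rootCount 1ℤ v ℕ.+ rootCount a v) ≡ p ℕ.* 2
      total = trans (∑-+ p (rootCount 1ℤ) (rootCount a))
        (trans (cong₂ ℕ._+_ (rootCount-total 1ℤ) (rootCount-total a))
        (trans (cong (p ℕ.+_) (sym (ℕ.+-identityʳ p))) (ℕ.*-comm 2 p)))

    -- The conics y² = δ + au² and ay² = δ + au² together have two points for
    -- each u, and the second is a hyperbola.
    smoothCount-nonzero : ∀ {δ} → ¬ δ ≈ 0ℤ [ 𝕡 ] → smoothCount p a δ ≡ suc p
    smoothCount-nonzero {δ} δ≉0 = ℕ.+-cancelʳ-≡ q _ _ (begin
      smoothCount p a δ ℕ.+ q
        ≡⟨ cong₂ ℕ._+_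
             (∑-cong p λ u → ∑-cong p λ y →
               ⟦⟧-cong (smoothConic? 𝕡 a δ u y) (1ℤ * (y * y) ≈? δ + u * u * a [ 𝕡 ])
                 (λ (h , _) → lin₁ 1ℤ h (solve (u ∷ y ∷ a ∷ δ ∷ [])))
                 (λ h → lin₁ 1ℤ h (solve (u ∷ y ∷ a ∷ δ ∷ [])) ,
                        λ (u≈0 , y≈0) → δ≉0 (lin₃ -1ℤ (- (u * a)) y h u≈0 y≈0
                          (solve (u ∷ y ∷ a ∷ δ ∷ [])))))
             (sym twisted) ⟩
      ∑ p (λ u → rootCount 1ℤ (δ + u * u * a)) ℕ.+ ∑ p (λ u → rootCount a (δ + u * u * a))
        ≡⟨ ∑-+ p (λ u → rootCount 1ℤ (δ + u * u * a)) (λ u → rootCount a (δ + u * u * a)) ⟨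
      ∑ p (λ u → rootCount 1ℤ (δ + u * u * a) ℕ.+ rootCount a (δ + u * u * a))
        ≡⟨ ∑-const p 2 (λ u → rootCounts≡2 (δ + u * u * a)) ⟩
      p ℕ.* 2
        ≡⟨ trans (ℕ.*-comm p 2) (cong (p ℕ.+_) (ℕ.+-identityʳ p)) ⟩
      p ℕ.+ suc q
        ≡⟨ ℕ.+-suc p q ⟩
      suc p ℕ.+ q ∎)
      where
      open ≡-Reasoning
      -- Multiplying ay² = δ + au² by the inverse of `a` gives y² = a′δ + u², whose leading
      -- coefficient 1 is a square.
      a′ = proj₁ (inverse pr a a≉0)
      aa′ = proj₂ (inverse pr a a≉0)
      a′δ≉0 : ¬ a′ * δ ≈ 0ℤ [ 𝕡 ]
      a′δ≉0 = *-≉0 pr (inverseʳ≉0 {a} aa′) δ≉0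
      twist : ∀ u y a′ → a * a′ ≈ 1ℤ [ 𝕡 ] → a * (y * y) ≈ δ + u * u * a [ 𝕡 ] →
              Conic 𝕡 1ℤ (a′ * δ) u y
      twist u y a′ aa′ h = lin₂ a′ (u * u - y * y) h aa′ (solve (a ∷ a′ ∷ δ ∷ u ∷ y ∷ []))
      untwist : ∀ u y a′ → a * a′ ≈ 1ℤ [ 𝕡 ] → Conic 𝕡 1ℤ (a′ * δ) u y →
                a * (y * y) ≈ δ + u * u * a [ 𝕡 ]
      untwist u y a′ aa′ h = lin₂ a δ h aa′ (solve (a ∷ a′ ∷ δ ∷ u ∷ y ∷ []))
      twist-origin : ∀ u y → a * (y * y) ≈ δ + u * u * a [ 𝕡 ] → ¬ Origin 𝕡 u y
      twist-origin u y h (u≈0 , y≈0) = δ≉0 (lin₃ -1ℤ (- (u * a)) (a * y) h u≈0 y≈0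
        (solve (u ∷ y ∷ a ∷ δ ∷ [])))
      twisted : ∑ p (λ u → rootCount a (δ + u * u * a)) ≡ q
      twisted = begin
        ∑ p (λ u → rootCount a (δ + u * u * a))
          ≡⟨ (∑-cong p λ u → ∑-cong p λ y →
               ⟦⟧-cong (a * (y * y) ≈? δ + u * u * a [ 𝕡 ]) (smoothConic? 𝕡 1ℤ (a′ * δ) u y)
                 (λ h → twist u y a′ aa′ h , twist-origin u y h)
                 (λ (h , _) → untwist u y a′ aa′ h)) ⟩
        smoothCount p 1ℤ (a′ * δ)
          ≡⟨ square-count 1ℤ ≈-refl 1≉0 (a′ * δ) ⟩
        q ℕ.* ⟦ a′ * δ ≈? 0ℤ [ 𝕡 ] ⟧ ℕ.+ q
          ≡⟨ cong (λ n → q ℕ.* n ℕ.+ q) (⟦⟧-no (a′ * δ ≈? 0ℤ [ 𝕡 ]) a′δ≉0) ⟩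
        q ℕ.* 0 ℕ.+ q
          ≡⟨ cong (ℕ._+ q) (ℕ.*-zeroʳ q) ⟩
        q ∎

-- Points of y² = δ + u²(a + bu) modulo prime powers

⟦⟧-split : ∀ {P Q : Set} (P? : Dec P) (Q? : Dec Q) →
           ⟦ P? ⟧ ≡ ⟦ P? ×-dec Q? ⟧ ℕ.+ ⟦ P? ×-dec ¬? Q? ⟧
⟦⟧-split (yes _) (yes _) = refl
⟦⟧-split (yes _) (no _)  = refl
⟦⟧-split (no _)  (yes _) = refl
⟦⟧-split (no _)  (no _)  = refl

-- Hensel's step: `n * (l - r)` is the first-order part of an expansion and the remainder is a
-- multiple of `c * n`. It serves both Newton's iteration and, with its converse `lift-to`, the
-- lifting of smooth points.
lift-from : ∀ {x y l r k c} n → x - y ≡ n * (l - r) + c * n * k → l ≈ r [ c ] → x ≈ y [ c * n ]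
lift-from {k = k} {c} n e (congruent s e′) = congruent (s + k)
  (trans e (trans (cong (λ z → n * z + c * n * k) e′) (solve (n ∷ c ∷ s ∷ k ∷ []))))

lift-to : ∀ {x y l r k c} n .{{_ : NonZero n}} → x - y ≡ + n * (l - r) + c * + n * k →
          x ≈ y [ c * + n ] → l ≈ r [ c ]
lift-to {x} {y} {l} {r} {k} {c} n@(suc _) e (congruent s e′) = congruent (s - k)
  (ℤ.*-cancelˡ-≡ (+ n) (l - r) (c * (s - k)) (lemma (+ n) e e′))
  where
  lemma : ∀ n → x - y ≡ n * (l - r) + c * n * k → x - y ≡ c * n * s → n * (l - r) ≡ n * (c * (s - k))
  lemma n e e′ = begin
    n * (l - r)                            ≡⟨ solve (n ∷ l ∷ r ∷ c ∷ k ∷ []) ⟩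
    n * (l - r) + c * n * k - c * n * k    ≡⟨ cong (λ z → z - c * n * k) (trans (sym e) e′) ⟩
    c * n * s - c * n * k                  ≡⟨ solve (n ∷ c ∷ s ∷ k ∷ []) ⟩
    n * (c * (s - k))                      ∎
    where open ≡-Reasoning

module NodalCubic (q : ℕ) (pr : Prime (suc q)) (2≉0 : ¬ + 2 ≈ 0ℤ [ + suc q ])
                  (a : ℤ) (a≉0 : ¬ a ≈ 0ℤ [ + suc q ]) where

  private
    p = suc q
    𝕡 = + p

  Sol : ℤ → ℤ → ℤ → ℤ → ℤ → Set
  Sol n b δ u y = y * y ≈ δ + u * u * (a + b * u) [ n ]

  sol? : ∀ n b δ u y → Dec (Sol n b δ u y)
  sol? n b δ u y = y * y ≈? δ + u * u * (a + b * u) [ n ]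

  Sol-resp : ∀ {n} b δ {u u′ y y′} → u ≈ u′ [ n ] → y ≈ y′ [ n ] → Sol n b δ u y → Sol n b δ u′ y′
  Sol-resp b δ {u} {u′} {y} {y′} e e′ h =
    lin₃ 1ℤ ((u + u′) * a + b * (u * u + u * u′ + u′ * u′)) (- (y + y′)) h e e′
      (solve′ a)
    where
    solve′ : ∀ a → y′ * y′ - (δ + u′ * u′ * (a + b * u′)) ≡
             1ℤ * (y * y - (δ + u * u * (a + b * u))) +
             ((u + u′) * a + b * (u * u + u * u′ + u′ * u′)) * (u - u′) + - (y + y′) * (y - y′)
    solve′ a = solve (a ∷ b ∷ δ ∷ u ∷ u′ ∷ y ∷ y′ ∷ [])

  node? : ∀ n b δ u y → Dec (Sol n b δ u y × Origin 𝕡 u y)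
  node? n b δ u y = sol? n b δ u y ×-dec origin? 𝕡 u y

  smooth? : ∀ n b δ u y → Dec (Sol n b δ u y × ¬ Origin 𝕡 u y)
  smooth? n b δ u y = sol? n b δ u y ×-dec ¬? (origin? 𝕡 u y)

  solCount nodeCount smoothPoints : ℕ → ℤ → ℤ → ℕ
  solCount     n b δ = ∑ n λ u → ∑ n λ y → ⟦ sol? (+ n) b δ u y ⟧
  nodeCount    n b δ = ∑ n λ u → ∑ n λ y → ⟦ node? (+ n) b δ u y ⟧
  smoothPoints n b δ = ∑ n λ u → ∑ n λ y → ⟦ smooth? (+ n) b δ u y ⟧

  solCount-split : ∀ n b δ → solCount n b δ ≡ nodeCount n b δ ℕ.+ smoothPoints n b δ
  solCount-split n b δ = trans
    (∑-cong n λ u → trans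
      (∑-cong n λ y → ⟦⟧-split (sol? (+ n) b δ u y) (origin? 𝕡 u y))
      (∑-+ n (λ y → ⟦ node? (+ n) b δ u y ⟧) (λ y → ⟦ smooth? (+ n) b δ u y ⟧)))
    (∑-+ n (λ u → ∑ n λ y → ⟦ node? (+ n) b δ u y ⟧) (λ u → ∑ n λ y → ⟦ smooth? (+ n) b δ u y ⟧))

  -- A residue modulo pn that is divisible by p is p times a unique residue modulo n. This is the
  -- substitution (u, y) → (pu, py), made before anything is divided out.
  nodeCount-multiples : ∀ n b δ → nodeCount (p ℕ.* n) b δ ≡
    ∑ n λ u → ∑ n λ y → ⟦ sol? (+ (p ℕ.* n)) b δ (𝕡 * u) (𝕡 * y) ⟧
  nodeCount-multiples n b δ = begin
    ∑ (p ℕ.* n) (λ u → ∑ (p ℕ.* n) λ y → ⟦ node? (+ (p ℕ.* n)) b δ u y ⟧)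
      ≡⟨ ∑-multiples n p (λ u u≉0 → ∑-zero (p ℕ.* n) λ y →
           ⟦⟧-no (node? (+ (p ℕ.* n)) b δ u y) λ (_ , o) → u≉0 (proj₁ o)) ⟩
    ∑ n (λ u → ∑ (p ℕ.* n) λ y → ⟦ node? (+ (p ℕ.* n)) b δ (𝕡 * u) y ⟧)
      ≡⟨ ∑-cong n (λ u → ∑-multiples n p λ y y≉0 →
           ⟦⟧-no (node? (+ (p ℕ.* n)) b δ (𝕡 * u) y) λ (_ , o) → y≉0 (proj₂ o)) ⟩
    ∑ n (λ u → ∑ n λ y → ⟦ node? (+ (p ℕ.* n)) b δ (𝕡 * u) (𝕡 * y) ⟧)
      ≡⟨ (∑-cong n λ u → ∑-cong n λ y →
           ⟦⟧-cong (node? (+ (p ℕ.* n)) b δ (𝕡 * u) (𝕡 * y)) (sol? (+ (p ℕ.* n)) b δ (𝕡 * u) (𝕡 * y))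
             proj₁ (λ h → h , ≈-multiple u , ≈-multiple y)) ⟩
    ∑ n (λ u → ∑ n λ y → ⟦ sol? (+ (p ℕ.* n)) b δ (𝕡 * u) (𝕡 * y) ⟧) ∎
    where open ≡-Reasoning

  solCount-1 : ∀ b δ → solCount 1 b δ ≡ 1
  solCount-1 b δ = cong (λ n → n ℕ.+ 0 ℕ.+ 0)
    (⟦⟧-yes (sol? 1ℤ b δ 0ℤ 0ℤ) (congruent _ (sym (ℤ.*-identityˡ _))))

  -- Modulo p the only candidate is the origin, and it lies on the curve. The modulus is written
  -- `p ℕ.* 1` because `p ℕ.^ 1` reduces to that.
  nodeCount-p : ∀ b {δ} → δ ≈ 0ℤ [ 𝕡 ] → nodeCount (p ℕ.* 1) b δ ≡ 1
  nodeCount-p b {δ} δ≈0 = trans (nodeCount-multiples 1 b δ) (cong (λ n → n ℕ.+ 0 ℕ.+ 0)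
    (⟦⟧-yes (sol? (+ (p ℕ.* 1)) b δ (𝕡 * 0ℤ) (𝕡 * 0ℤ))
      (subst (λ n → Sol (+ n) b δ (𝕡 * 0ℤ) (𝕡 * 0ℤ)) (sym (ℕ.*-identityʳ p)) (at-0 𝕡 a δ≈0))))
    where
    at-0 : ∀ m a {n} → δ ≈ 0ℤ [ n ] → m * 0ℤ * (m * 0ℤ) ≈ δ + m * 0ℤ * (m * 0ℤ) * (a + b * (m * 0ℤ)) [ n ]
    at-0 m a h = lin₁ -1ℤ h (solve (m ∷ a ∷ b ∷ δ ∷ []))

  pos-p² : ∀ n → + (p ℕ.* (p ℕ.* n)) ≡ 𝕡 * (𝕡 * + n)
  pos-p² n = trans (ℤ.pos-* p (p ℕ.* n)) (cong (𝕡 *_) (ℤ.pos-* p n))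

  -- After c² is taken out, the cubic term keeps one factor `c`: this is where `b` becomes `c * b`.
  scaled : ∀ c m b δ u → c * (c * δ) + c * u * (c * u) * (m + b * (c * u)) ≡
                           c * (c * (δ + u * u * (m + c * b * u)))
  scaled c m b δ u = solve (c ∷ m ∷ b ∷ δ ∷ u ∷ [])

  square-scaled : ∀ c y → c * y * (c * y) ≡ c * (c * (y * y))
  square-scaled c y = solve (c ∷ y ∷ [])

  -- Once p² is cancelled, the equation depends on `u` and `y` modulo `n` only, while both still
  -- range over residues modulo pn; each of them contributes a factor p.
  nodeCount-descent : ∀ n b δ → nodeCount (p ℕ.* (p ℕ.* n)) b (𝕡 * (𝕡 * δ)) ≡
                                p ℕ.* (p ℕ.* solCount n (𝕡 * b) δ)
  nodeCount-descent n b δ = begin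
    nodeCount p²n b (𝕡 * (𝕡 * δ))
      ≡⟨ nodeCount-multiples (p ℕ.* n) b (𝕡 * (𝕡 * δ)) ⟩
    ∑ (p ℕ.* n) (λ u → ∑ (p ℕ.* n) λ y → ⟦ sol? (+ p²n) b (𝕡 * (𝕡 * δ)) (𝕡 * u) (𝕡 * y) ⟧)
      ≡⟨ (∑-cong (p ℕ.* n) λ u → ∑-cong (p ℕ.* n) λ y →
           ⟦⟧-cong (sol? (+ p²n) b (𝕡 * (𝕡 * δ)) (𝕡 * u) (𝕡 * y)) (sol? (+ n) (𝕡 * b) δ u y)
             (down u y) (up u y)) ⟩
    ∑ (p ℕ.* n) (λ u → ∑ (p ℕ.* n) λ y → F u y)
      ≡⟨ ∑-cong (p ℕ.* n) (λ u → ∑-periodic p n (F u) (F-cong (≈-refl {a = u}))) ⟩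
    ∑ (p ℕ.* n) (λ u → p ℕ.* ∑ n (F u))
      ≡⟨ ∑-*ˡ (p ℕ.* n) p (λ u → ∑ n (F u)) ⟩
    p ℕ.* ∑ (p ℕ.* n) (λ u → ∑ n (F u))
      ≡⟨ cong (p ℕ.*_) (∑-periodic p n (λ u → ∑ n (F u)) λ e → ∑-cong n λ y → F-cong e (≈-refl {a = y})) ⟩
    p ℕ.* (p ℕ.* solCount n (𝕡 * b) δ) ∎
    where
    open ≡-Reasoning
    p²n = p ℕ.* (p ℕ.* n)
    F : ℤ → ℤ → ℕ
    F u y = ⟦ sol? (+ n) (𝕡 * b) δ u y ⟧
    F-cong : ∀ {u u′ y y′} → u ≈ u′ [ + n ] → y ≈ y′ [ + n ] → F u y ≡ F u′ y′
    F-cong {u} {u′} {y} {y′} e e′ = ⟦⟧-cong (sol? (+ n) (𝕡 * b) δ u y) (sol? (+ n) (𝕡 * b) δ u′ y′)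
      (Sol-resp (𝕡 * b) δ e e′) (Sol-resp (𝕡 * b) δ (≈-sym e) (≈-sym e′))
    down : ∀ u y → Sol (+ p²n) b (𝕡 * (𝕡 * δ)) (𝕡 * u) (𝕡 * y) → Sol (+ n) (𝕡 * b) δ u y
    down u y h = ≈-unscale p (≈-unscale p
      (subst₂ (λ l r → l ≈ r [ 𝕡 * (𝕡 * + n) ]) (square-scaled 𝕡 y) (scaled 𝕡 a b δ u)
        (subst (λ m → Sol m b (𝕡 * (𝕡 * δ)) (𝕡 * u) (𝕡 * y)) (pos-p² n) h)))
    up : ∀ u y → Sol (+ n) (𝕡 * b) δ u y → Sol (+ p²n) b (𝕡 * (𝕡 * δ)) (𝕡 * u) (𝕡 * y)
    up u y h = subst (λ m → Sol m b (𝕡 * (𝕡 * δ)) (𝕡 * u) (𝕡 * y)) (sym (pos-p² n))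
      (subst₂ (λ l r → l ≈ r [ 𝕡 * (𝕡 * + n) ]) (sym (square-scaled 𝕡 y)) (sym (scaled 𝕡 a b δ u))
        (≈-scale 𝕡 (≈-scale 𝕡 h)))

  -- With `u` and `y` multiples of p, every term of the equation other than `δ` is divisible by p².
  nodeCount-none : ∀ n b {δ} → ¬ δ ≈ 0ℤ [ 𝕡 * 𝕡 ] → nodeCount (p ℕ.* (p ℕ.* n)) b δ ≡ 0
  nodeCount-none n b {δ} δ≉0 = trans (nodeCount-multiples (p ℕ.* n) b δ)
    (∑-zero (p ℕ.* n) λ u → ∑-zero (p ℕ.* n) λ y →
      ⟦⟧-no (sol? (+ (p ℕ.* (p ℕ.* n))) b δ (𝕡 * u) (𝕡 * y)) λ h →
        δ≉0 (lemma 𝕡 a u y (≈-weaken (+ n)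
          (subst (λ m → Sol m b δ (𝕡 * u) (𝕡 * y)) (trans (pos-p² n) (sym (ℤ.*-assoc 𝕡 𝕡 (+ n)))) h))))
    where
    lemma : ∀ c a u y → c * y * (c * y) ≈ δ + c * u * (c * u) * (a + b * (c * u)) [ c * c ] →
            δ ≈ 0ℤ [ c * c ]
    lemma c a u y h = lin₂ -1ℤ (y * y - u * u * (a + b * (c * u))) h (≈-multiple {c * c} 1ℤ)
      (solve (c ∷ a ∷ b ∷ δ ∷ u ∷ y ∷ []))

  -- The case of a unit `δ`, which has to include the modulus p itself, out of reach of
  -- `nodeCount-none`.
  nodeCount-none₁ : ∀ n b {δ} → ¬ δ ≈ 0ℤ [ 𝕡 ] → nodeCount (p ℕ.* n) b δ ≡ 0
  nodeCount-none₁ n b {δ} δ≉0 = trans (nodeCount-multiples n b δ)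
    (∑-zero n λ u → ∑-zero n λ y →
      ⟦⟧-no (sol? (+ (p ℕ.* n)) b δ (𝕡 * u) (𝕡 * y)) λ h →
        δ≉0 (lemma 𝕡 a u y (≈-weaken (+ n)
          (subst (λ m → Sol m b δ (𝕡 * u) (𝕡 * y)) (ℤ.pos-* p n) h))))
    where
    lemma : ∀ c a u y → c * y * (c * y) ≈ δ + c * u * (c * u) * (a + b * (c * u)) [ c ] →
            δ ≈ 0ℤ [ c ]
    lemma c a u y h = lin₂ -1ℤ (c * (y * y - u * u * (a + b * (c * u)))) h (≈-multiple {c} 1ℤ)
      (solve (c ∷ a ∷ b ∷ δ ∷ u ∷ y ∷ []))

  smoothPoints-p : ∀ {b} → b ≈ 0ℤ [ 𝕡 ] → ∀ δ → smoothPoints (p ℕ.* 1) b δ ≡ smoothCount p a δ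
  smoothPoints-p {b} b≈0 δ = trans (cong (λ n → smoothPoints n b δ) (ℕ.*-identityʳ p))
    (∑-cong p λ u → ∑-cong p λ y →
      ⟦⟧-cong (smooth? 𝕡 b δ u y) (smoothConic? 𝕡 a δ u y)
        (λ (h , ¬o) → to a u y h , ¬o) (λ (h , ¬o) → from a u y h , ¬o))
    where
    to : ∀ a u y → y * y ≈ δ + u * u * (a + b * u) [ 𝕡 ] → y * y ≈ δ + u * u * a [ 𝕡 ]
    to a u y h = lin₂ 1ℤ (u * u * u) h b≈0 (solve (a ∷ b ∷ δ ∷ u ∷ y ∷ []))
    from : ∀ a u y → y * y ≈ δ + u * u * a [ 𝕡 ] → y * y ≈ δ + u * u * (a + b * u) [ 𝕡 ]
    from a u y h = lin₂ 1ℤ (- (u * u * u)) h b≈0 (solve (a ∷ b ∷ δ ∷ u ∷ y ∷ []))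

  -- The lifts (u + ns, y + nt) of a smooth point modulo n to points modulo pn
  -- form an affine line in (s, t) over 𝔽ₚ.
  module Lifting (m : ℕ) .{{_ : NonZero m}} (b₀ δ : ℤ) where

    private
      n = p ℕ.* m
      b = 𝕡 * b₀
      instance
        n≢0 : NonZero n
        n≢0 = ℕ.m*n≢0 p m

    -- Since p ∣ b, the gradient of the equation modulo p is (-2au, 2y), and away from the origin
    -- one entry is a unit: solve for `t` if `y ≉ 0`, and for `s` otherwise.
    line-count : ∀ E u y → ¬ Origin 𝕡 u y →
      ∑ p (λ s → ∑ p λ t → ⟦ + 2 * y * t ≈? + 2 * u * a * s - E [ 𝕡 ] ⟧) ≡ p
    line-count E u y ¬o with y ≈? 0ℤ [ 𝕡 ]
    ... | no y≉0 = trans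
          (∑-const p 1 λ s → ∑-linear p (+ 2 * y)
            (inverse pr (+ 2 * y) (*-≉0 pr 2≉0 y≉0)) (+ 2 * u * a * s - E))
          (ℕ.*-identityʳ p)
    ... | yes y≈0 = trans (∑-swap p p (λ s t → ⟦ + 2 * y * t ≈? + 2 * u * a * s - E [ 𝕡 ] ⟧)) (trans
          (∑-const p 1 λ t → trans
            (∑-cong p λ s → ⟦⟧-cong (+ 2 * y * t ≈? + 2 * u * a * s - E [ 𝕡 ])
                                    (+ 2 * u * a * s ≈? + 2 * y * t + E [ 𝕡 ])
                                    (flip a s t) (unflip a s t))
            (∑-linear p (+ 2 * u * a) (inverse pr (+ 2 * u * a)
              (*-≉0 pr (*-≉0 pr 2≉0 λ u≈0 → ¬o (u≈0 , y≈0)) a≉0)) (+ 2 * y * t + E)))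
          (ℕ.*-identityʳ p))
      where
      flip : ∀ a s t → + 2 * y * t ≈ + 2 * u * a * s - E [ 𝕡 ] → + 2 * u * a * s ≈ + 2 * y * t + E [ 𝕡 ]
      flip a s t h = lin₁ -1ℤ h (solve (a ∷ s ∷ t ∷ u ∷ y ∷ E ∷ []))
      unflip : ∀ a s t → + 2 * u * a * s ≈ + 2 * y * t + E [ 𝕡 ] → + 2 * y * t ≈ + 2 * u * a * s - E [ 𝕡 ]
      unflip a s t h = lin₁ -1ℤ h (solve (a ∷ s ∷ t ∷ u ∷ y ∷ E ∷ []))

    shift-n : ∀ s u → + n * s + u ≈ u [ + n ]
    shift-n s u = lemma (+ n)
      where
      lemma : ∀ n → n * s + u ≈ u [ n ]
      lemma n = congruent s (solve (n ∷ s ∷ u ∷ []))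

    shift-p : ∀ s u → + n * s + u ≈ u [ 𝕡 ]
    shift-p s u = ≈-weaken (+ m) (subst (λ k → + n * s + u ≈ u [ k ]) (ℤ.pos-* p m) (shift-n s u))

    forget : ∀ s t u y → Sol (+ (p ℕ.* n)) b δ (+ n * s + u) (+ n * t + y) → Sol (+ n) b δ u y
    forget s t u y h = Sol-resp b δ (shift-n s u) (shift-n t y)
      (≈-weaken 𝕡 (subst (λ k → Sol k b δ (+ n * s + u) (+ n * t + y))
        (trans (ℤ.pos-* p n) (ℤ.*-comm 𝕡 (+ n))) h))

    -- Taylor expansion at (u, y) with increments ns and nt, where `E` is the value there divided by
    -- n. The quadratic terms carry n² = cn·m, and the derivative of cb₀u³ carries the factor `c`,
    -- so all of them go into the remainder.
    expansion : ∀ a c m n E s t u y → n ≡ c * m →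
      y * y - (δ + u * u * (a + c * b₀ * u)) ≡ n * E →
      (n * t + y) * (n * t + y) -
        (δ + (n * s + u) * (n * s + u) * (a + c * b₀ * (n * s + u)))
      ≡ n * (+ 2 * y * t - (+ 2 * u * a * s - E))
        + c * n * (m * t * t - + 2 * s * u * b₀ * (u + n * s)
                   - m * s * s * (a + c * b₀ * u + c * b₀ * n * s) - u * u * b₀ * s)
    expansion a c m n E s t u y refl e = begin
      (c * m * t + y) * (c * m * t + y) -
        (δ + (c * m * s + u) * (c * m * s + u) * (a + c * b₀ * (c * m * s + u)))
        ≡⟨ solve (a ∷ c ∷ m ∷ s ∷ t ∷ u ∷ y ∷ δ ∷ b₀ ∷ []) ⟩
      c * m * (+ 2 * y * t - + 2 * u * a * s) + (y * y - (δ + u * u * (a + c * b₀ * u)))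
        + c * (c * m) * (m * t * t - + 2 * s * u * b₀ * (u + c * m * s)
          - m * s * s * (a + c * b₀ * u + c * b₀ * (c * m) * s) - u * u * b₀ * s)
        ≡⟨ cong (λ z → c * m * (+ 2 * y * t - + 2 * u * a * s) + z
             + c * (c * m) * (m * t * t - + 2 * s * u * b₀ * (u + c * m * s)
               - m * s * s * (a + c * b₀ * u + c * b₀ * (c * m) * s) - u * u * b₀ * s)) e ⟩
      c * m * (+ 2 * y * t - + 2 * u * a * s) + c * m * E
        + c * (c * m) * (m * t * t - + 2 * s * u * b₀ * (u + c * m * s)
          - m * s * s * (a + c * b₀ * u + c * b₀ * (c * m) * s) - u * u * b₀ * s)
        ≡⟨ solve (a ∷ c ∷ m ∷ s ∷ t ∷ u ∷ y ∷ E ∷ b₀ ∷ []) ⟩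
      c * m * (+ 2 * y * t - (+ 2 * u * a * s - E))
        + c * (c * m) * (m * t * t - + 2 * s * u * b₀ * (u + c * m * s)
          - m * s * s * (a + c * b₀ * u + c * b₀ * (c * m) * s) - u * u * b₀ * s) ∎
      where open ≡-Reasoning

    lifts-count : ∀ u y → Sol (+ n) b δ u y → ¬ Origin 𝕡 u y →
      ∑ p (λ s → ∑ p λ t → ⟦ smooth? (+ (p ℕ.* n)) b δ (+ n * s + u) (+ n * t + y) ⟧) ≡ p
    lifts-count u y h@(congruent E e) ¬o = trans
      (∑-cong p λ s → ∑-cong p λ t →
        ⟦⟧-cong (smooth? (+ (p ℕ.* n)) b δ (+ n * s + u) (+ n * t + y))
                (+ 2 * y * t ≈? + 2 * u * a * s - E [ 𝕡 ])
          (λ (h′ , _) → to s t h′)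
          (λ l → from s t l , ¬o ∘ Origin-resp (shift-p s u) (shift-p t y)))
      (line-count E u y ¬o)
      where
      ex = λ s t → expansion a 𝕡 (+ m) (+ n) E s t u y (ℤ.pos-* p m) e
      to : ∀ s t → Sol (+ (p ℕ.* n)) b δ (+ n * s + u) (+ n * t + y) →
           + 2 * y * t ≈ + 2 * u * a * s - E [ 𝕡 ]
      to s t h′ = lift-to n (ex s t)
        (subst (λ k → Sol k b δ (+ n * s + u) (+ n * t + y)) (ℤ.pos-* p n) h′)
      from : ∀ s t → + 2 * y * t ≈ + 2 * u * a * s - E [ 𝕡 ] →
             Sol (+ (p ℕ.* n)) b δ (+ n * s + u) (+ n * t + y)
      from s t l = subst (λ k → Sol k b δ (+ n * s + u) (+ n * t + y)) (sym (ℤ.pos-* p n))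
        (lift-from (+ n) (ex s t) l)

    smoothPoints-lift : smoothPoints (p ℕ.* n) b δ ≡ p ℕ.* smoothPoints n b δ
    smoothPoints-lift = begin
      ∑ (p ℕ.* n) (λ u → ∑ (p ℕ.* n) λ y → G u y)
        ≡⟨ ∑-blocks p n (λ u → ∑ (p ℕ.* n) λ y → G u y) ⟩
      ∑ p (λ s → ∑ n λ u → ∑ (p ℕ.* n) λ y → G (+ n * s + u) y)
        ≡⟨ (∑-cong p λ s → ∑-cong n λ u → ∑-blocks p n (λ y → G (+ n * s + u) y)) ⟩
      ∑ p (λ s → ∑ n λ u → ∑ p λ t → ∑ n λ y → G (+ n * s + u) (+ n * t + y))
        ≡⟨ ∑-swap p n (λ s u → ∑ p λ t → ∑ n λ y → G (+ n * s + u) (+ n * t + y)) ⟩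
      ∑ n (λ u → ∑ p λ s → ∑ p λ t → ∑ n λ y → G (+ n * s + u) (+ n * t + y))
        ≡⟨ (∑-cong n λ u → ∑-cong p λ s → ∑-swap p n (λ t y → G (+ n * s + u) (+ n * t + y))) ⟩
      ∑ n (λ u → ∑ p λ s → ∑ n λ y → ∑ p λ t → G (+ n * s + u) (+ n * t + y))
        ≡⟨ ∑-cong n (λ u → ∑-swap p n (λ s y → ∑ p λ t → G (+ n * s + u) (+ n * t + y))) ⟩
      ∑ n (λ u → ∑ n λ y → ∑ p λ s → ∑ p λ t → G (+ n * s + u) (+ n * t + y))
        -- With the leading digits `s` and `t` innermost, the inner double sum runs over the fibre
        -- above a fixed (u, y) modulo n.
        ≡⟨ (∑-cong n λ u → ∑-cong n λ y → fibre u y (smooth? (+ n) b δ u y)) ⟩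
      ∑ n (λ u → ∑ n λ y → p ℕ.* ⟦ smooth? (+ n) b δ u y ⟧)
        ≡⟨ ∑-cong n (λ u → ∑-*ˡ n p (λ y → ⟦ smooth? (+ n) b δ u y ⟧)) ⟩
      ∑ n (λ u → p ℕ.* ∑ n λ y → ⟦ smooth? (+ n) b δ u y ⟧)
        ≡⟨ ∑-*ˡ n p (λ u → ∑ n λ y → ⟦ smooth? (+ n) b δ u y ⟧) ⟩
      p ℕ.* smoothPoints n b δ ∎
      where
      open ≡-Reasoning
      G : ℤ → ℤ → ℕ
      G u y = ⟦ smooth? (+ (p ℕ.* n)) b δ u y ⟧
      fibre : ∀ u y (d : Dec (Sol (+ n) b δ u y × ¬ Origin 𝕡 u y)) →
              ∑ p (λ s → ∑ p λ t → G (+ n * s + u) (+ n * t + y)) ≡ p ℕ.* ⟦ d ⟧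
      fibre u y (yes (h , ¬o)) = trans (lifts-count u y h ¬o) (sym (ℕ.*-identityʳ p))
      fibre u y (no ¬h) = trans
        (∑-zero p λ s → ∑-zero p λ t →
          ⟦⟧-no (smooth? (+ (p ℕ.* n)) b δ (+ n * s + u) (+ n * t + y)) λ (h , ¬o) →
            ¬h (forget s t u y h , ¬o ∘ Origin-resp (≈-sym (shift-p s u)) (≈-sym (shift-p t y))))
        (sym (ℕ.*-zeroʳ p))

-- Indices are shifted by one: for k ≥ 1 and pᵏ ∣ δ the count modulo pᵏ is
-- pᵏ⁻¹ times lowFactor (k − 1), and for δ of valuation n with 1 ≤ n < k it is
-- pᵏ⁻¹ times highFactor (n − 1).
lowFactor : (p s₀ : ℕ) → ℕ → ℕ
lowFactor p s₀ zero          = 1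
lowFactor p s₀ (suc zero)    = p
lowFactor p s₀ (suc (suc k)) = lowFactor p s₀ k ℕ.+ s₀

highFactor : (s₀ s₁ : ℕ) → ℕ → ℕ
highFactor s₀ s₁ zero          = 0
highFactor s₀ s₁ (suc zero)    = s₁
highFactor s₀ s₁ (suc (suc i)) = highFactor s₀ s₁ i ℕ.+ s₀

-- If p² ∣ δ, blowing up the origin leaves the same problem for δ/p² together
-- with the smooth points of y² = δ/p² + au² modulo p.
module NodeFormula (q : ℕ) (pr : Prime (suc q)) (2≉0 : ¬ + 2 ≈ 0ℤ [ + suc q ])
                   (a : ℤ) (a≉0 : ¬ a ≈ 0ℤ [ + suc q ]) (s₀ s₁ : ℕ)
                   (count-0 : ∀ {δ} → δ ≈ 0ℤ [ + suc q ] → smoothCount (suc q) a δ ≡ s₀)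
                   (count-≉0 : ∀ {δ} → ¬ δ ≈ 0ℤ [ + suc q ] → smoothCount (suc q) a δ ≡ s₁) where

  open NodalCubic q pr 2≉0 a a≉0

  private
    p = suc q
    𝕡 = + p

  smoothPoints-^ : ∀ k b₀ δ → smoothPoints (p ℕ.^ suc k) (𝕡 * b₀) δ ≡ p ℕ.^ k ℕ.* smoothCount p a δ
  smoothPoints-^ zero    b₀ δ = trans (smoothPoints-p (≈-multiple b₀) δ) (sym (ℕ.*-identityˡ _))
  smoothPoints-^ (suc k) b₀ δ = begin
    smoothPoints (p ℕ.^ suc (suc k)) (𝕡 * b₀) δ
      ≡⟨ Lifting.smoothPoints-lift (p ℕ.^ k) {{ℕ.m^n≢0 p k}} b₀ δ ⟩
    p ℕ.* smoothPoints (p ℕ.^ suc k) (𝕡 * b₀) δ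
      ≡⟨ cong (p ℕ.*_) (smoothPoints-^ k b₀ δ) ⟩
    p ℕ.* (p ℕ.^ k ℕ.* smoothCount p a δ)
      ≡⟨ ℕ.*-assoc p (p ℕ.^ k) (smoothCount p a δ) ⟨
    p ℕ.^ suc k ℕ.* smoothCount p a δ ∎
    where open ≡-Reasoning

  -- The exponent starts at 3 so that after the descent the modulus is still divisible by p, and
  -- points can be sorted by their reduction.
  nodeCount-step : ∀ j b δ → nodeCount (p ℕ.^ (3 ℕ.+ j)) b (𝕡 * (𝕡 * δ)) ≡
    p ℕ.* (p ℕ.* (nodeCount (p ℕ.^ suc j) (𝕡 * b) δ ℕ.+ p ℕ.^ j ℕ.* smoothCount p a δ))
  nodeCount-step j b δ = trans (nodeCount-descent (p ℕ.^ suc j) b δ)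
    (cong (λ n → p ℕ.* (p ℕ.* n)) (trans (solCount-split (p ℕ.^ suc j) (𝕡 * b) δ)
      (cong (nodeCount (p ℕ.^ suc j) (𝕡 * b) δ ℕ.+_) (smoothPoints-^ j b δ))))

  divide-p² : ∀ {n δ} → δ ≈ 0ℤ [ + (p ℕ.* (p ℕ.* n)) ] → ∃ λ δ′ → δ ≡ 𝕡 * (𝕡 * δ′) × δ′ ≈ 0ℤ [ + n ]
  divide-p² {n} {δ} (congruent s e) = + n * s , eq , ≈-multiple s
    where
    open ≡-Reasoning
    eq : δ ≡ 𝕡 * (𝕡 * (+ n * s))
    eq = begin
      δ                              ≡⟨ ℤ.+-identityʳ δ ⟨
      δ - 0ℤ                         ≡⟨ e ⟩
      + (p ℕ.* (p ℕ.* n)) * s        ≡⟨ cong (_* s) (pos-p² n) ⟩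
      𝕡 * (𝕡 * + n) * s              ≡⟨ trans (ℤ.*-assoc 𝕡 (𝕡 * + n) s) (cong (𝕡 *_) (ℤ.*-assoc 𝕡 (+ n) s)) ⟩
      𝕡 * (𝕡 * (+ n * s))            ∎

  multiply-p² : ∀ {n δ} → δ ≈ 0ℤ [ + n ] → 𝕡 * (𝕡 * δ) ≈ 0ℤ [ + (p ℕ.* (p ℕ.* n)) ]
  multiply-p² {n} {δ} h = subst (λ m → 𝕡 * (𝕡 * δ) ≈ 0ℤ [ m ]) (sym (pos-p² n))
    (subst (λ z → 𝕡 * (𝕡 * δ) ≈ z [ 𝕡 * (𝕡 * + n) ])
      (trans (cong (𝕡 *_) (ℤ.*-zeroʳ 𝕡)) (ℤ.*-zeroʳ 𝕡)) (≈-scale 𝕡 (≈-scale 𝕡 h)))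

  mod-p : ∀ {n δ} → δ ≈ 0ℤ [ + (p ℕ.* n) ] → δ ≈ 0ℤ [ 𝕡 ]
  mod-p {n} {δ} h = ≈-weaken (+ n) (subst (λ m → δ ≈ 0ℤ [ m ]) (ℤ.pos-* p n) h)

  -- Induction in steps of two. The base cases are the moduli p, where the node alone remains, and
  -- p², where the descent ends modulo 1 and every pair is a solution.
  nodeCount-low : ∀ k b δ → δ ≈ 0ℤ [ + (p ℕ.^ suc k) ] →
                  nodeCount (p ℕ.^ suc k) b δ ≡ p ℕ.^ k ℕ.* lowFactor p s₀ k
  nodeCount-low zero b δ h = nodeCount-p b (mod-p h)
  nodeCount-low (suc k) b δ h with divide-p² {p ℕ.^ k} h
  nodeCount-low (suc zero) b _ h | δ , refl , _ = begin
    nodeCount (p ℕ.^ 2) b (𝕡 * (𝕡 * δ))    ≡⟨ nodeCount-descent 1 b δ ⟩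
    p ℕ.* (p ℕ.* solCount 1 (𝕡 * b) δ)     ≡⟨ cong (λ n → p ℕ.* (p ℕ.* n)) (solCount-1 (𝕡 * b) δ) ⟩
    p ℕ.* (p ℕ.* 1)                        ≡⟨ rearrange p ⟩
    p ℕ.* 1 ℕ.* p                          ∎
    where
    open ≡-Reasoning
    rearrange : ∀ p → p ℕ.* (p ℕ.* 1) ≡ p ℕ.* 1 ℕ.* p
    rearrange = ℕ.solve-∀
  nodeCount-low (suc (suc k)) b _ h | δ , refl , h′ = begin
    nodeCount (p ℕ.^ (3 ℕ.+ k)) b (𝕡 * (𝕡 * δ))
      ≡⟨ nodeCount-step k b δ ⟩
    p ℕ.* (p ℕ.* (nodeCount (p ℕ.^ suc k) (𝕡 * b) δ ℕ.+ p ℕ.^ k ℕ.* smoothCount p a δ))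
      ≡⟨ cong (λ n → p ℕ.* (p ℕ.* n)) (cong₂ ℕ._+_ (nodeCount-low k (𝕡 * b) δ h′)
           (cong (p ℕ.^ k ℕ.*_) (count-0 (mod-p h′)))) ⟩
    p ℕ.* (p ℕ.* (p ℕ.^ k ℕ.* lowFactor p s₀ k ℕ.+ p ℕ.^ k ℕ.* s₀))
      ≡⟨ rearrange p (p ℕ.^ k) (lowFactor p s₀ k) s₀ ⟩
    p ℕ.^ suc (suc k) ℕ.* lowFactor p s₀ (suc (suc k)) ∎
    where
    open ≡-Reasoning
    rearrange : ∀ p n l s → p ℕ.* (p ℕ.* (n ℕ.* l ℕ.+ n ℕ.* s)) ≡ p ℕ.* (p ℕ.* n) ℕ.* (l ℕ.+ s)
    rearrange = ℕ.solve-∀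

  -- The exponent exceeds the valuation `suc i` by `suc d`, and the descent preserves this
  -- difference. Valuation 1 admits no solution; valuation 2 turns into a unit, so that only the
  -- smooth points of a nondegenerate conic remain.
  nodeCount-high : ∀ i d b δ → δ ≈ 0ℤ [ + (p ℕ.^ suc i) ] → ¬ δ ≈ 0ℤ [ + (p ℕ.^ suc (suc i)) ] →
                   nodeCount (p ℕ.^ (2 ℕ.+ i ℕ.+ d)) b δ ≡ p ℕ.^ (1 ℕ.+ i ℕ.+ d) ℕ.* highFactor s₀ s₁ i
  nodeCount-high zero d b δ h ¬h = trans
    (nodeCount-none (p ℕ.^ d) b (¬h ∘ subst (λ m → δ ≈ 0ℤ [ m ])
      (trans (cong (𝕡 *_) (sym (ℤ.*-identityʳ 𝕡))) (sym (pos-p² 1)))))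
    (sym (ℕ.*-zeroʳ (p ℕ.^ suc d)))
  nodeCount-high (suc i) d b δ h ¬h with divide-p² {p ℕ.^ i} h
  nodeCount-high (suc zero) d b _ h ¬h | δ , refl , _ = begin
    nodeCount (p ℕ.^ (3 ℕ.+ d)) b (𝕡 * (𝕡 * δ))
      ≡⟨ nodeCount-step d b δ ⟩
    p ℕ.* (p ℕ.* (nodeCount (p ℕ.^ suc d) (𝕡 * b) δ ℕ.+ p ℕ.^ d ℕ.* smoothCount p a δ))
      ≡⟨ cong (λ n → p ℕ.* (p ℕ.* n)) (cong₂ ℕ._+_ (nodeCount-none₁ (p ℕ.^ d) (𝕡 * b) δ≉0)
           (cong (p ℕ.^ d ℕ.*_) (count-≉0 δ≉0))) ⟩
    p ℕ.* (p ℕ.* (p ℕ.^ d ℕ.* s₁))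
      ≡⟨ rearrange p (p ℕ.^ d) s₁ ⟩
    p ℕ.^ suc (suc d) ℕ.* s₁ ∎
    where
    open ≡-Reasoning
    rearrange : ∀ p n s → p ℕ.* (p ℕ.* (n ℕ.* s)) ≡ p ℕ.* (p ℕ.* n) ℕ.* s
    rearrange = ℕ.solve-∀
    δ≉0 : ¬ δ ≈ 0ℤ [ 𝕡 ]
    δ≉0 e = ¬h (multiply-p² {p ℕ.* 1} (subst (λ m → δ ≈ 0ℤ [ + m ]) (sym (ℕ.*-identityʳ p)) e))
  nodeCount-high (suc (suc i)) d b _ h ¬h | δ , refl , h′ = begin
    nodeCount (p ℕ.^ (3 ℕ.+ (1 ℕ.+ i ℕ.+ d))) b (𝕡 * (𝕡 * δ))
      ≡⟨ nodeCount-step (1 ℕ.+ i ℕ.+ d) b δ ⟩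
    p ℕ.* (p ℕ.* (nodeCount (p ℕ.^ (2 ℕ.+ i ℕ.+ d)) (𝕡 * b) δ ℕ.+ n ℕ.* smoothCount p a δ))
      ≡⟨ cong (λ n → p ℕ.* (p ℕ.* n)) (cong₂ ℕ._+_
           (nodeCount-high i d (𝕡 * b) δ h′ (¬h ∘ multiply-p² {p ℕ.^ suc (suc i)}))
           (cong (n ℕ.*_) (count-0 (mod-p h′)))) ⟩
    p ℕ.* (p ℕ.* (n ℕ.* highFactor s₀ s₁ i ℕ.+ n ℕ.* s₀))
      ≡⟨ rearrange p n (highFactor s₀ s₁ i) s₀ ⟩
    p ℕ.* (p ℕ.* n) ℕ.* (highFactor s₀ s₁ i ℕ.+ s₀) ∎
    where
    open ≡-Reasoning
    n = p ℕ.^ (1 ℕ.+ i ℕ.+ d)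
    rearrange : ∀ p n l s → p ℕ.* (p ℕ.* (n ℕ.* l ℕ.+ n ℕ.* s)) ≡ p ℕ.* (p ℕ.* n) ℕ.* (l ℕ.+ s)
    rearrange = ℕ.solve-∀

-- Counting over lists

length-filter-tabulate : ∀ {A : Set} {P : A → Set} (P? : ∀ x → Dec (P x)) {n} (f : Fin n → A) →
                         length (filter P? (tabulate f)) ≡ sum (λ i → ⟦ P? (f i) ⟧)
length-filter-tabulate P? {zero}  f = refl
length-filter-tabulate P? {suc n} f with P? (f zero)
... | yes _ = cong suc (length-filter-tabulate P? (f ∘ suc))
... | no  _ = length-filter-tabulate P? (f ∘ suc)

length-filter-product : ∀ {A B : Set} {P : A × B → Set} (P? : ∀ x → Dec (P x)) {m n}
                        (f : Fin m → A) (g : Fin n → B) →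
                        length (filter P? (cartesianProduct (tabulate f) (tabulate g))) ≡
                        sum (λ i → sum (λ j → ⟦ P? (f i , g j) ⟧))
length-filter-product P? {zero}  f g = refl
length-filter-product {A} {B} P? {suc m} f g = begin
  length (filter P? (row ++ rest))              ≡⟨ cong length (filter-++ P? row rest) ⟩
  length (filter P? row ++ filter P? rest)      ≡⟨ length-++ (filter P? row) ⟩
  length (filter P? row) ℕ.+ length (filter P? rest)
    ≡⟨ cong₂ ℕ._+_
         (trans (cong (length ∘ filter P?) (map-tabulate g (f zero ,_)))
                (length-filter-tabulate P? (λ j → f zero , g j)))
         (length-filter-product P? (f ∘ suc) g) ⟩
  sum (λ i → sum (λ j → ⟦ P? (f i , g j) ⟧))    ∎
  where
  open ≡-Reasoning
  row rest : List (A × B)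
  row  = map (f zero ,_) (tabulate g)
  rest = cartesianProduct (tabulate (f ∘ suc)) (tabulate g)

-- Repeated roots

-- The formal derivative in Horner form: (a + xP)′ = P + xP′.
deriv : Poly → ℤ → ℤ
deriv []      _ = 0ℤ
deriv (a ∷ P) x = eval P x + x * deriv P x

module _ (n : ℕ) (x : ℤ) where

  private
    horner-cong : ∀ {a b y z} → a ≈ b [ + n ] → y ≈ z [ + n ] → a + x * y ≈ b + x * z [ + n ]
    horner-cong {a} {b} {y} {z} h h′ = lin₂ 1ℤ x h h′ (lemma x)
      where
      lemma : ∀ x → a + x * y - (b + x * z) ≡ 1ℤ * (a - b) + x * (y - z)
      lemma x = solve (a ∷ b ∷ x ∷ y ∷ z ∷ [])

    0-horner : 0ℤ ≈ 0ℤ + x * 0ℤ [ + n ]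
    0-horner = ≈-reflexive (sym (trans (ℤ.+-identityˡ _) (ℤ.*-zeroʳ x)))

  -- Congruent polynomials may have lists of different lengths, so an empty list is also compared
  -- with one whose coefficients all vanish modulo n.
  eval-cong : ∀ P Q → P ≡ₚ Q [mod n ] → eval P x ≈ eval Q x [ + n ]
  eval-cong []      []      h = ≈-refl
  eval-cong []      (b ∷ Q) h = ≈-trans 0-horner
    (horner-cong (≡mod⇒≈ {0ℤ} {b} (h 0)) (eval-cong [] Q (λ i → h (suc i))))
  eval-cong (a ∷ P) []      h = ≈-trans
    (horner-cong (≡mod⇒≈ {a} {0ℤ} (h 0)) (eval-cong P [] (λ i → h (suc i)))) (≈-sym 0-horner)
  eval-cong (a ∷ P) (b ∷ Q) h = horner-cong (≡mod⇒≈ {a} {b} (h 0)) (eval-cong P Q (λ i → h (suc i)))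

  deriv-cong : ∀ P Q → P ≡ₚ Q [mod n ] → deriv P x ≈ deriv Q x [ + n ]
  deriv-cong []      []      h = ≈-refl
  deriv-cong []      (b ∷ Q) h = ≈-trans 0-horner
    (horner-cong (eval-cong [] Q (λ i → h (suc i))) (deriv-cong [] Q (λ i → h (suc i))))
  deriv-cong (a ∷ P) []      h = ≈-trans
    (horner-cong (eval-cong P [] (λ i → h (suc i))) (deriv-cong P [] (λ i → h (suc i)))) (≈-sym 0-horner)
  deriv-cong (a ∷ P) (b ∷ Q) h =
    horner-cong (eval-cong P Q (λ i → h (suc i))) (deriv-cong P Q (λ i → h (suc i)))

module _ (x : ℤ) where

  eval-⊕ : ∀ P Q → eval (P ⊕ Q) x ≡ eval P x + eval Q x
  eval-⊕ []      Q       = sym (ℤ.+-identityˡ _)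
  eval-⊕ (a ∷ P) []      = sym (ℤ.+-identityʳ _)
  eval-⊕ (a ∷ P) (b ∷ Q) = trans (cong (λ z → a + b + x * z) (eval-⊕ P Q))
    (lemma a b x (eval P x) (eval Q x))
    where
    lemma : ∀ a b x y z → a + b + x * (y + z) ≡ a + x * y + (b + x * z)
    lemma = solve-∀

  eval-scale : ∀ c P → eval (map (c *_) P) x ≡ c * eval P x
  eval-scale c []      = sym (ℤ.*-zeroʳ c)
  eval-scale c (a ∷ P) = trans (cong (λ z → c * a + x * z) (eval-scale c P)) (lemma c a x (eval P x))
    where
    lemma : ∀ c a x y → c * a + x * (c * y) ≡ c * (a + x * y)
    lemma = solve-∀

  eval-⊗ : ∀ P Q → eval (P ⊗ Q) x ≡ eval P x * eval Q x
  eval-⊗ []      Q = refl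
  eval-⊗ (a ∷ P) Q = begin
    eval (map (a *_) Q ⊕ (0ℤ ∷ P ⊗ Q)) x              ≡⟨ eval-⊕ (map (a *_) Q) (0ℤ ∷ P ⊗ Q) ⟩
    eval (map (a *_) Q) x + (0ℤ + x * eval (P ⊗ Q) x)
      ≡⟨ cong₂ (λ y z → y + (0ℤ + x * z)) (eval-scale a Q) (eval-⊗ P Q) ⟩
    a * eval Q x + (0ℤ + x * (eval P x * eval Q x))   ≡⟨ lemma a x (eval P x) (eval Q x) ⟩
    (a + x * eval P x) * eval Q x                     ∎
    where
    open ≡-Reasoning
    lemma : ∀ a x y z → a * z + (0ℤ + x * (y * z)) ≡ (a + x * y) * z
    lemma = solve-∀

  deriv-⊕ : ∀ P Q → deriv (P ⊕ Q) x ≡ deriv P x + deriv Q x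
  deriv-⊕ []      Q       = sym (ℤ.+-identityˡ _)
  deriv-⊕ (a ∷ P) []      = sym (ℤ.+-identityʳ _)
  deriv-⊕ (a ∷ P) (b ∷ Q) = trans (cong₂ (λ y z → y + x * z) (eval-⊕ P Q) (deriv-⊕ P Q))
    (lemma x (eval P x) (eval Q x) (deriv P x) (deriv Q x))
    where
    lemma : ∀ x a b y z → a + b + x * (y + z) ≡ a + x * y + (b + x * z)
    lemma = solve-∀

  deriv-scale : ∀ c P → deriv (map (c *_) P) x ≡ c * deriv P x
  deriv-scale c []      = sym (ℤ.*-zeroʳ c)
  deriv-scale c (a ∷ P) = trans (cong₂ (λ y z → y + x * z) (eval-scale c P) (deriv-scale c P))
    (lemma c x (eval P x) (deriv P x))
    where
    lemma : ∀ c x a y → c * a + x * (c * y) ≡ c * (a + x * y)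
    lemma = solve-∀

  deriv-⊗ : ∀ P Q → deriv (P ⊗ Q) x ≡ deriv P x * eval Q x + eval P x * deriv Q x
  deriv-⊗ []      Q = refl
  deriv-⊗ (a ∷ P) Q = begin
    deriv (map (a *_) Q ⊕ (0ℤ ∷ P ⊗ Q)) x  ≡⟨ deriv-⊕ (map (a *_) Q) (0ℤ ∷ P ⊗ Q) ⟩
    deriv (map (a *_) Q) x + (eval (P ⊗ Q) x + x * deriv (P ⊗ Q) x)
      ≡⟨ cong₂ _+_ (deriv-scale a Q) (cong₂ (λ y z → y + x * z) (eval-⊗ P Q) (deriv-⊗ P Q)) ⟩
    a * deriv Q x + (eval P x * eval Q x + x * (deriv P x * eval Q x + eval P x * deriv Q x))
      ≡⟨ lemma a x (eval P x) (eval Q x) (deriv P x) (deriv Q x) ⟩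
    (eval P x + x * deriv P x) * eval Q x + (a + x * eval P x) * deriv Q x ∎
    where
    open ≡-Reasoning
    lemma : ∀ a x y z y′ z′ → a * z′ + (y * z + x * (y′ * z + y * z′)) ≡
                              (y + x * y′) * z + (a + x * y) * z′
    lemma = solve-∀

repeatedRoot⇒eval≈0 : ∀ {p} P (ρ : Fin p) → RepeatedRoot p P ρ → eval P (rep ρ) ≈ 0ℤ [ + p ]
repeatedRoot⇒eval≈0 {p} P ρ (Q , h) = ≈-trans
  (eval-cong p (rep ρ) P ((X- rep ρ) ⊗ (X- rep ρ) ⊗ Q) h)
  (≈-reflexive (begin
    eval ((X- r) ⊗ (X- r) ⊗ Q) r                  ≡⟨ eval-⊗ r ((X- r) ⊗ (X- r)) Q ⟩
    eval ((X- r) ⊗ (X- r)) r * eval Q r           ≡⟨ cong (_* eval Q r) (eval-⊗ r (X- r) (X- r)) ⟩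
    eval (X- r) r * eval (X- r) r * eval Q r      ≡⟨ lemma r (eval Q r) ⟩
    0ℤ                                            ∎))
  where
  open ≡-Reasoning
  r = rep ρ
  lemma : ∀ r z → (- r + r * (1ℤ + r * 0ℤ)) * (- r + r * (1ℤ + r * 0ℤ)) * z ≡ 0ℤ
  lemma = solve-∀

-- In the product rule every term keeps a factor X - ρ, which vanishes at ρ.
repeatedRoot⇒deriv≈0 : ∀ {p} P (ρ : Fin p) → RepeatedRoot p P ρ → deriv P (rep ρ) ≈ 0ℤ [ + p ]
repeatedRoot⇒deriv≈0 {p} P ρ (Q , h) = ≈-trans
  (deriv-cong p (rep ρ) P ((X- rep ρ) ⊗ (X- rep ρ) ⊗ Q) h)
  (≈-reflexive (begin
    deriv ((X- r) ⊗ (X- r) ⊗ Q) r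
      ≡⟨ deriv-⊗ r ((X- r) ⊗ (X- r)) Q ⟩
    deriv ((X- r) ⊗ (X- r)) r * eval Q r + eval ((X- r) ⊗ (X- r)) r * deriv Q r
      ≡⟨ cong₂ (λ y z → y * eval Q r + z * deriv Q r) (deriv-⊗ r (X- r) (X- r)) (eval-⊗ r (X- r) (X- r)) ⟩
    (deriv (X- r) r * eval (X- r) r + eval (X- r) r * deriv (X- r) r) * eval Q r
      + eval (X- r) r * eval (X- r) r * deriv Q r
      ≡⟨ lemma r (deriv (X- r) r) (eval Q r) (deriv Q r) ⟩
    0ℤ ∎))
  where
  open ≡-Reasoning
  r = rep ρ
  lemma : ∀ r d z z′ →
    (d * (- r + r * (1ℤ + r * 0ℤ)) + (- r + r * (1ℤ + r * 0ℤ)) * d) * z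
      + (- r + r * (1ℤ + r * 0ℤ)) * (- r + r * (1ℤ + r * 0ℤ)) * z′ ≡ 0ℤ
  lemma = solve-∀

-- The Legendre symbol

legendre≡1⇒square : ∀ a p → legendre a p ≡ 1ℤ → ∃ λ x → x * x ≈ a [ + p ]
legendre≡1⇒square a p h with a ≡? 0ℤ [mod p ]
... | yes _ = case h of λ ()
... | no  _ with any? {n = p} (λ x → rep x ^ 2 ≡? a [mod p ])
...   | yes (x , e) = rep x , subst (λ z → z ≈ a [ + p ]) (cong (rep x *_) (ℤ.*-identityʳ (rep x))) (≡mod⇒≈ e)
...   | no _ = case h of λ ()

legendre≡-1⇒nonsquare : ∀ a p .{{_ : NonZero p}} → legendre a p ≡ -1ℤ → ∀ x → ¬ x * x ≈ a [ + p ]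
legendre≡-1⇒nonsquare a p h x e with a ≡? 0ℤ [mod p ]
... | yes _ = case h of λ ()
... | no  _ with any? {n = p} (λ x → rep x ^ 2 ≡? a [mod p ])
...   | yes _   = case h of λ ()
...   | no none = none (residue p x , ≈⇒≡mod
        (subst (λ z → z ≈ a [ + p ]) (cong (rep (residue p x) *_) (sym (ℤ.*-identityʳ (rep (residue p x)))))
          (lemma (rep (residue p x)) (rep-residue p x) e)))
  where
  lemma : ∀ r → r ≈ x [ + p ] → x * x ≈ a [ + p ] → r * r ≈ a [ + p ]
  lemma r h e = lin₂ (r + x) 1ℤ h e (solve (r ∷ x ∷ a ∷ []))

-- The critical point near the node

≈-∣ : ∀ {a b m n} → m ℕ.∣ n → a ≈ b [ + n ] → a ≈ b [ + m ]
≈-∣ {a} {b} {m} {n} (ℕ.divides k n≡km) h =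
  ≈-weaken (+ k) (subst (λ d → a ≈ b [ d ]) (trans (cong +_ (trans n≡km (ℕ.*-comm k m))) (ℤ.pos-* m k)) h)

^-∣-^ : ∀ p {j k} → j ≤ k → p ℕ.^ j ℕ.∣ p ℕ.^ k
^-∣-^ p {j} {k} j≤k = ℕ.divides (p ℕ.^ (k ∸ j))
  (trans (cong (p ℕ.^_) (sym (ℕ.m∸n+n≡m j≤k))) (ℕ.^-distribˡ-+-* p (k ∸ j) j))

-- Induction on `j`: p divides ex, hence x; cancel p from the congruence and continue with x/p.
*-cancel-unit : ∀ {p} (pr : Prime p) {e} → ¬ e ≈ 0ℤ [ + p ] → ∀ j x →
                e * x ≈ 0ℤ [ + (p ℕ.^ j) ] → x ≈ 0ℤ [ + (p ℕ.^ j) ]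
*-cancel-unit pr e≉0 zero x _ = congruent (x - 0ℤ) (sym (ℤ.*-identityˡ _))
*-cancel-unit {p} pr {e} e≉0 (suc j) x h with ≈0-split pr e x (≈-∣ (ℕ.m∣m*n (p ℕ.^ j)) h)
... | inj₁ e≈0 = contradiction e≈0 e≉0
... | inj₂ (congruent t x≡pt) =
  subst₂ (λ a d → a ≈ 0ℤ [ d ]) (sym x≡) (sym (ℤ.pos-* p (p ℕ.^ j)))
    (subst (λ z → + p * t ≈ z [ + p * + (p ℕ.^ j) ]) (ℤ.*-zeroʳ (+ p))
      (≈-scale (+ p) (*-cancel-unit pr e≉0 j t
        (≈-unscale p {{prime⇒nonZero pr}}
          (subst₂ (λ a d → a ≈ + p * 0ℤ [ d ]) (trans (cong (e *_) x≡) (swap e (+ p) t)) (ℤ.pos-* p (p ℕ.^ j))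
            (subst (λ z → e * x ≈ z [ + (p ℕ.^ suc j) ]) (sym (ℤ.*-zeroʳ (+ p))) h))))))
  where
  x≡ : x ≡ + p * t
  x≡ = trans (sym (ℤ.+-identityʳ x)) x≡pt
  swap : ∀ e p t → e * (p * t) ≡ p * (e * t)
  swap = solve-∀

module Node (q : ℕ) (pr : Prime (suc q))
            (2≉0 : ¬ + 2 ≈ 0ℤ [ + suc q ]) (3≉0 : ¬ + 3 ≈ 0ℤ [ + suc q ])
            (A B r : ℤ) (A≉0 : ¬ A ≈ 0ℤ [ + suc q ])
            (root : r * r * r + A * r + B ≈ 0ℤ [ + suc q ])
            (double : + 3 * r * r + A ≈ 0ℤ [ + suc q ]) where

  private
    p = suc q
    𝕡 = + p

  -- At `c ≈ 0` the derivative reduces to the unit `A`. This makes f″(c) = 6c a unit, as Newton's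
  -- iteration requires, and the double point a node.
  critical≉0 : ∀ c → + 3 * c * c + A ≈ 0ℤ [ 𝕡 ] → ¬ c ≈ 0ℤ [ 𝕡 ]
  critical≉0 c h c≈0 = A≉0 (lin₂ 1ℤ (- (+ 3 * c)) h c≈0 (solve (A ∷ c ∷ [])))

  3c≉0 : ∀ c → + 3 * c * c + A ≈ 0ℤ [ 𝕡 ] → ¬ + 3 * c ≈ 0ℤ [ 𝕡 ]
  3c≉0 c h = *-≉0 pr 3≉0 (critical≉0 c h)

  -- Newton's iteration for f′ = 3x² + A.
  critical : ∀ k → ∃ λ c → c ≈ r [ 𝕡 ] × + 3 * c * c + A ≈ 0ℤ [ + (p ℕ.^ suc k) ]
  critical zero = r , ≈-refl , subst (λ n → + 3 * r * r + A ≈ 0ℤ [ + n ]) (sym (ℕ.*-identityʳ p)) double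
  critical (suc k) = refine (critical k)
    where
    n = p ℕ.^ suc k
    m = p ℕ.^ k
    refine : (∃ λ c → c ≈ r [ 𝕡 ] × + 3 * c * c + A ≈ 0ℤ [ + n ]) →
             ∃ λ c → c ≈ r [ 𝕡 ] × + 3 * c * c + A ≈ 0ℤ [ + (p ℕ.* n) ]
    refine (c , c≈r , h@(congruent t e)) = c + + n * s ,
      near (+ n) (≈-∣ (ℕ.m∣m*n m) (≈-multiple s)) ,
      subst (λ d → + 3 * (c + + n * s) * (c + + n * s) + A ≈ 0ℤ [ d ]) (sym (ℤ.pos-* p n))
        (lift-from (+ n) (expand 𝕡 (+ m) (+ n) s (ℤ.pos-* p m) e) (kill s′ (proj₂ inv)))
      where
      6c≉0 : ¬ + 2 * (+ 3 * c) ≈ 0ℤ [ 𝕡 ]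
      6c≉0 = *-≉0 pr 2≉0 (3c≉0 c (≈-∣ (ℕ.m∣m*n m) h))
      inv = inverse pr (+ 2 * (+ 3 * c)) 6c≉0
      s′ = proj₁ inv
      -- The Newton correction -f′(c)/f″(c): `t` is f′(c)/n, and `s′` inverts f″(c) = 6c modulo p.
      s = - (t * s′)
      near : ∀ n → n * s ≈ 0ℤ [ 𝕡 ] → c + n * s ≈ r [ 𝕡 ]
      near n h = lemma (n * s) h
        where
        lemma : ∀ z → z ≈ 0ℤ [ 𝕡 ] → c + z ≈ r [ 𝕡 ]
        lemma z h = lin₂ 1ℤ 1ℤ c≈r h (solve (c ∷ r ∷ z ∷ []))
      kill : ∀ i → + 2 * (+ 3 * c) * i ≈ 1ℤ [ 𝕡 ] → t + + 2 * (+ 3 * c) * - (t * i) ≈ 0ℤ [ 𝕡 ]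
      kill i h = lin₁ (- t) h (solve (t ∷ c ∷ i ∷ []))
      expand : ∀ p m n s → n ≡ p * m → + 3 * c * c + A - 0ℤ ≡ n * t →
               + 3 * (c + n * s) * (c + n * s) + A - 0ℤ ≡
               n * (t + + 2 * (+ 3 * c) * s - 0ℤ) + p * n * (+ 3 * m * s * s)
      expand p m n s refl e = begin
        + 3 * (c + p * m * s) * (c + p * m * s) + A - 0ℤ
          ≡⟨ solve (p ∷ m ∷ s ∷ c ∷ A ∷ []) ⟩
        (+ 3 * c * c + A - 0ℤ) + p * m * (+ 2 * (+ 3 * c) * s) + p * (p * m) * (+ 3 * m * s * s)
          ≡⟨ cong (λ z → z + p * m * (+ 2 * (+ 3 * c) * s) + p * (p * m) * (+ 3 * m * s * s)) e ⟩
        p * m * t + p * m * (+ 2 * (+ 3 * c) * s) + p * (p * m) * (+ 3 * m * s * s)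
          ≡⟨ solve (p ∷ m ∷ s ∷ c ∷ t ∷ []) ⟩
        p * m * (t + + 2 * (+ 3 * c) * s - 0ℤ) + p * (p * m) * (+ 3 * m * s * s) ∎
        where open ≡-Reasoning

  CurvePoint : ℕ → ℤ → ℤ → Set
  CurvePoint n x y = y * y ≈ x * x * x + A * x + B [ + n ] × x ≈ r [ 𝕡 ] × y ≈ 0ℤ [ 𝕡 ]

  curvePoint? : ∀ n x y → Dec (CurvePoint n x y)
  curvePoint? n x y = (y * y ≈? x * x * x + A * x + B [ + n ]) ×-dec
                      (x ≈? r [ 𝕡 ]) ×-dec (y ≈? 0ℤ [ 𝕡 ])

  module AtCritical (k : ℕ) (c : ℤ) (c≈r : c ≈ r [ 𝕡 ])
                    (crit : + 3 * c * c + A ≈ 0ℤ [ + (p ℕ.^ suc k) ]) where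

    n : ℕ
    n = p ℕ.^ suc k

    δ : ℤ
    δ = c * c * c + A * c + B

    crit-p : + 3 * c * c + A ≈ 0ℤ [ 𝕡 ]
    crit-p = ≈-∣ (ℕ.m∣m*n (p ℕ.^ k)) crit

    c≉0 : ¬ c ≈ 0ℤ [ 𝕡 ]
    c≉0 = critical≉0 c crit-p

    δ≈0 : c * c * c + A * c + B ≈ 0ℤ [ 𝕡 ]
    δ≈0 = lin₂ 1ℤ (c * c + c * r + r * r + A) root c≈r (solve (A ∷ B ∷ c ∷ r ∷ []))

    2c²≉0 : ¬ + 2 * c * c ≈ 0ℤ [ 𝕡 ]
    2c²≉0 = *-≉0 pr (*-≉0 pr 2≉0 c≉0) c≉0

    -- Modulo p^(k+1), Δ = 27(B − 2c³)(B + 2c³) and f(c) = B − 2c³.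
    discriminant : + 27 * (B + + 2 * c * c * c) * (c * c * c + A * c + B) ≈
                   + 4 * (A * A * A) + + 27 * (B * B) [ + n ]
    discriminant = lin₁
      -- The first term comes from f(c) - (B - 2c³) = c·f′(c), the second from A³ + (3c²)³, which is
      -- divisible by A + 3c² = f′(c).
      (+ 27 * c * (B + + 2 * c * c * c) - + 4 * (A * A - + 3 * c * c * A + + 9 * c * c * c * c))
      crit (solve (A ∷ B ∷ c ∷ []))

    -- Modulo p, δ ≈ 0 says B ≈ 2c³, so the second factor is 4c³; the primes 2 and 3 and `c` are all
    -- units.
    cofactor≉0 : ¬ + 27 * (B + + 2 * c * c * c) ≈ 0ℤ [ 𝕡 ]
    cofactor≉0 = *-≉0 pr {+ 27} {B + + 2 * c * c * c} 27≉0 (λ h → 4c³≉0 (lin₃ 1ℤ -1ℤ c h δ≈0 crit-p (solve (A ∷ B ∷ c ∷ []))))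
      where
      27≉0 : ¬ + 3 * (+ 3 * + 3) ≈ 0ℤ [ 𝕡 ]
      27≉0 = *-≉0 pr 3≉0 (*-≉0 pr 3≉0 3≉0)
      4c³≉0 : ¬ + 2 * c * (+ 2 * c * c) ≈ 0ℤ [ 𝕡 ]
      4c³≉0 = *-≉0 pr (*-≉0 pr 2≉0 c≉0) 2c²≉0

    -- Modulo p, A ≈ -3c² and B ≈ 2c³, so both sides are 12c⁵.
    twisted-class : - (+ 2) * A * B ≈ + 3 * c * (+ 2 * c * c) * (+ 2 * c * c) [ 𝕡 ]
    twisted-class = lin₂ (- (+ 2 * B) - + 6 * c * c * c) (+ 6 * c * c) crit-p δ≈0 (solve (A ∷ B ∷ c ∷ []))

    square-class : ∀ x → x * x ≈ - (+ 2) * A * B [ 𝕡 ] → ∃ λ g → g * g ≈ + 3 * c [ 𝕡 ]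
    square-class x h = x * proj₁ inv , lemma (proj₁ inv) (proj₂ inv) (≈-trans h twisted-class)
      where
      inv = inverse pr (+ 2 * c * c) 2c²≉0
      lemma : ∀ w → + 2 * c * c * w ≈ 1ℤ [ 𝕡 ] →
              x * x ≈ + 3 * c * (+ 2 * c * c) * (+ 2 * c * c) [ 𝕡 ] → x * w * (x * w) ≈ + 3 * c [ 𝕡 ]
      lemma w hw h = lin₂ (w * w) (+ 3 * c * (+ 2 * c * c * w + 1ℤ)) h hw (solve (x ∷ w ∷ c ∷ []))

    nonsquare-class : (∀ x → ¬ x * x ≈ - (+ 2) * A * B [ 𝕡 ]) → ∀ g → ¬ g * g ≈ + 3 * c [ 𝕡 ]
    nonsquare-class none g h = none (g * (+ 2 * c * c))
      (lin₂ ((+ 2 * c * c) * (+ 2 * c * c)) -1ℤ h twisted-class (solve (A ∷ B ∷ g ∷ c ∷ [])))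

    open NodalCubic q pr 2≉0 (+ 3 * c) (3c≉0 c crit-p) using (nodeCount; node?)

    -- Taylor expansion of f at `c`: f(c + u) = δ + u·f′(c) + u²(3c + u), where the linear term
    -- vanishes modulo `n` by the choice of `c`. The leading coefficient of f is the initial value 1
    -- of b.
    curveCount : ∑ n (λ x → ∑ n λ y → ⟦ curvePoint? n x y ⟧) ≡ nodeCount n 1ℤ δ
    curveCount = trans (sym (∑-translate n {{ℕ.m^n≢0 p (suc k)}} (λ x → ∑ n λ y → ⟦ curvePoint? n x y ⟧)
        (λ {x} {x′} e → ∑-cong n λ y → ⟦⟧-cong (curvePoint? n x y) (curvePoint? n x′ y)
          (resp x x′ y e) (resp x′ x y (≈-sym e))) c))
      (∑-cong n λ u → ∑-cong n λ y →
        ⟦⟧-cong (curvePoint? n (c + u) y) (node? (+ n) 1ℤ δ u y) (to u y) (from u y))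
      where
      resp : ∀ x x′ y → x ≈ x′ [ + n ] → CurvePoint n x y → CurvePoint n x′ y
      resp x x′ y e (h , x≈r , y≈0) =
        lin₂ 1ℤ (x * x + x * x′ + x′ * x′ + A) h e (solve (A ∷ B ∷ x ∷ x′ ∷ y ∷ [])) ,
        ≈-trans (≈-sym (≈-∣ (ℕ.m∣m*n (p ℕ.^ k)) e)) x≈r , y≈0
      to : ∀ u y → CurvePoint n (c + u) y →
           y * y ≈ c * c * c + A * c + B + u * u * (+ 3 * c + 1ℤ * u) [ + n ] × Origin 𝕡 u y
      to u y (h , x≈r , y≈0) = lin₂ 1ℤ u h crit (solve (A ∷ B ∷ c ∷ u ∷ y ∷ [])) ,
        lin₂ 1ℤ -1ℤ x≈r c≈r (solve (c ∷ u ∷ r ∷ [])) , y≈0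
      from : ∀ u y →
             y * y ≈ c * c * c + A * c + B + u * u * (+ 3 * c + 1ℤ * u) [ + n ] × Origin 𝕡 u y →
             CurvePoint n (c + u) y
      from u y (h , u≈0 , y≈0) = lin₂ 1ℤ (- u) h crit (solve (A ∷ B ∷ c ∷ u ∷ y ∷ [])) ,
        lin₂ 1ℤ 1ℤ u≈0 c≈r (solve (c ∷ u ∷ r ∷ [])) , y≈0

-- Divisibility of Δ and the closed forms of the factors

pos-^ : ∀ p k → + (p ℕ.^ k) ≡ (+ p) ^ k
pos-^ p zero    = refl
pos-^ p (suc k) = trans (ℤ.pos-* p (p ℕ.^ k)) (cong (+ p *_) (pos-^ p k))

pos-Δ : ∀ A B → + Δ A B ≡ + 4 * (+ A * + A * + A) + + 27 * (+ B * + B)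
pos-Δ A B = trans
  (cong₂ _+_ (trans (ℤ.pos-* 4 (A ℕ.^ 3)) (cong (+ 4 *_) (pos-^ A 3)))
             (trans (ℤ.pos-* 27 (B ℕ.^ 2)) (cong (+ 27 *_) (pos-^ B 2))))
  (lemma (+ A) (+ B))
  where
  lemma : ∀ A B → + 4 * (A * (A * (A * 1ℤ))) + + 27 * (B * (B * 1ℤ)) ≡ + 4 * (A * A * A) + + 27 * (B * B)
  lemma = solve-∀

small≉0 : ∀ {p n} → suc n < p → ¬ + suc n ≈ 0ℤ [ + p ]
small≉0 {p} n<p h = ℕ.<⇒≱ n<p (∣⇒≤ (≈0⇒∣ {p} h))

≤∞⇒^-∣ : ∀ {p n k} m → HasValuation p n m → fin k ≤∞ m → p ℕ.^ k ∣ n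
≤∞⇒^-∣ {p} (fin _) (d , _) [ k≤m ] = ℕ.∣-trans (^-∣-^ p k≤m) d
≤∞⇒^-∣ {p} {k = k} ∞ refl _ = (p ℕ.^ k) ℕ.∣0

-- Every two steps add 2q, and the initial values 1 and p = q + 1 already differ by q, so both
-- parities lie on one line.
lowFactor-square : ∀ q k → lowFactor (suc q) (q ℕ.+ q) k ≡ k ℕ.* q ℕ.+ 1
lowFactor-square q zero          = refl
lowFactor-square q (suc zero)    = lemma q
  where
  lemma : ∀ q → 1 ℕ.+ q ≡ 1 ℕ.* q ℕ.+ 1
  lemma = ℕ.solve-∀
lowFactor-square q (suc (suc k)) = trans (cong (ℕ._+ (q ℕ.+ q)) (lowFactor-square q k)) (lemma q k)
  where
  lemma : ∀ q k → k ℕ.* q ℕ.+ 1 ℕ.+ (q ℕ.+ q) ≡ (2 ℕ.+ k) ℕ.* q ℕ.+ 1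
  lemma = ℕ.solve-∀

highFactor-square : ∀ q i → highFactor (q ℕ.+ q) q i ≡ i ℕ.* q
highFactor-square q zero          = refl
highFactor-square q (suc zero)    = sym (ℕ.+-identityʳ q)
highFactor-square q (suc (suc i)) = trans (cong (ℕ._+ (q ℕ.+ q)) (highFactor-square q i)) (lemma q i)
  where
  lemma : ∀ q i → i ℕ.* q ℕ.+ (q ℕ.+ q) ≡ (2 ℕ.+ i) ℕ.* q
  lemma = ℕ.solve-∀

-- With s₀ = 0 the factor is 1 for even k and p for odd k, so it rounds the exponent k up to an even
-- number.
lowFactor-nonsquare : ∀ p k → p ℕ.^ k ℕ.* lowFactor p 0 k ≡ p ℕ.^ (2 ℕ.* (suc k / 2))
lowFactor-nonsquare p zero          = refl
lowFactor-nonsquare p (suc zero)    = lemma p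
  where
  lemma : ∀ p → p ℕ.* 1 ℕ.* p ≡ p ℕ.* (p ℕ.* 1)
  lemma = ℕ.solve-∀
lowFactor-nonsquare p (suc (suc k)) = begin
  p ℕ.* (p ℕ.* p ℕ.^ k) ℕ.* (lowFactor p 0 k ℕ.+ 0)  ≡⟨ lemma p (p ℕ.^ k) (lowFactor p 0 k) ⟩
  p ℕ.* (p ℕ.* (p ℕ.^ k ℕ.* lowFactor p 0 k))        ≡⟨ cong (λ z → p ℕ.* (p ℕ.* z)) (lowFactor-nonsquare p k) ⟩
  p ℕ.^ (2 ℕ.+ 2 ℕ.* (suc k / 2))
    ≡⟨ cong (p ℕ.^_) (sym (trans (cong (2 ℕ.*_) (m/n≡1+[m∸n]/n {3 ℕ.+ k} {2} (ℕ.s≤s (ℕ.s≤s ℕ.z≤n))))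
                                 (ℕ.*-suc 2 (suc k / 2)))) ⟩
  p ℕ.^ (2 ℕ.* ((3 ℕ.+ k) / 2))                      ∎
  where
  open ≡-Reasoning
  lemma : ∀ p n l → p ℕ.* (p ℕ.* n) ℕ.* (l ℕ.+ 0) ≡ p ℕ.* (p ℕ.* (n ℕ.* l))
  lemma = ℕ.solve-∀

-- The recursion adds 0 and keeps the parity of the valuation `suc i`; an odd one comes down to 1,
-- an even one to 2, where `s` is picked up.
highFactor-odd : ∀ s i → ¬ (2 ∣ suc i) → highFactor 0 s i ≡ 0
highFactor-odd s zero          _ = refl
highFactor-odd s (suc zero)    h = contradiction ℕ.∣-refl h
highFactor-odd s (suc (suc i)) h = trans (ℕ.+-identityʳ _)
  (highFactor-odd s i (h ∘ ℕ.∣m∣n⇒∣m+n {2} {2} ℕ.∣-refl))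

highFactor-even : ∀ s i → 2 ∣ suc i → highFactor 0 s i ≡ s
highFactor-even s zero          h = contradiction (∣⇒≤ h) λ { (ℕ.s≤s ()) }
highFactor-even s (suc zero)    _ = refl
highFactor-even s (suc (suc i)) h = trans (ℕ.+-identityʳ _)
  (highFactor-even s i (∣m+n∣m⇒∣n {2} {2} h ℕ.∣-refl))

module Count (q A B : ℕ) (pr : Prime (suc q)) (5≤p : 5 ≤ suc q) (p∤A : ¬ (suc q ∣ A))
             (ρ : Fin (suc q)) (repeated : RepeatedRoot (suc q) (cubic A B) ρ) (k : ℕ) where

  private
    p = suc q
    𝕡 = + p

  2≉0 : ¬ + 2 ≈ 0ℤ [ 𝕡 ]
  2≉0 = small≉0 (ℕ.≤-trans (ℕ.s≤s (ℕ.s≤s (ℕ.s≤s ℕ.z≤n))) 5≤p)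

  3≉0 : ¬ + 3 ≈ 0ℤ [ 𝕡 ]
  3≉0 = small≉0 (ℕ.≤-trans (ℕ.s≤s (ℕ.s≤s (ℕ.s≤s (ℕ.s≤s ℕ.z≤n)))) 5≤p)

  eval-cubic : ∀ x → eval (cubic A B) x ≡ x * x * x + + A * x + + B
  eval-cubic x = lemma (+ A) (+ B) x
    where
    lemma : ∀ A B x → B + x * (A + x * (0ℤ + x * (1ℤ + x * 0ℤ))) ≡ x * x * x + A * x + B
    lemma = solve-∀

  deriv-cubic : ∀ x → deriv (cubic A B) x ≡ + 3 * x * x + + A
  deriv-cubic x = lemma (+ A) x
    where
    lemma : ∀ A x → A + x * (0ℤ + x * (1ℤ + x * 0ℤ)) + x * (0ℤ + x * (1ℤ + x * 0ℤ) + x * (1ℤ + x * 0ℤ + x * (0ℤ + x * 0ℤ)))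
                    ≡ + 3 * x * x + A
    lemma = solve-∀

  open Node q pr 2≉0 3≉0 (+ A) (+ B) (rep ρ) (p∤A ∘ ≈0⇒∣)
    (subst (_≈ 0ℤ [ 𝕡 ]) (eval-cubic (rep ρ)) (repeatedRoot⇒eval≈0 (cubic A B) ρ repeated))
    (subst (_≈ 0ℤ [ 𝕡 ]) (deriv-cubic (rep ρ)) (repeatedRoot⇒deriv≈0 (cubic A B) ρ repeated))

  c : ℤ
  c = proj₁ (critical k)

  open AtCritical k c (proj₁ (proj₂ (critical k))) (proj₂ (proj₂ (critical k)))

  a≉0 : ¬ + 3 * c ≈ 0ℤ [ 𝕡 ]
  a≉0 = 3c≉0 c crit-p

  open NodalCubic q pr 2≉0 (+ 3 * c) a≉0 using (nodeCount)

  M≡nodeCount : M (cubic A B) ρ (suc k) ≡ nodeCount n 1ℤ δ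
  M≡nodeCount = trans
    (length-filter-product (onCurveAbove? (cubic A B) ρ (suc k)) (λ i → i) (λ j → j))
    (trans (sum-cong-≗ λ x → sum-cong-≗ λ y →
      ⟦⟧-cong (onCurveAbove? (cubic A B) ρ (suc k) (x , y)) (curvePoint? n (rep x) (rep y))
        (λ (h , h′ , h″) → subst₂ (λ l r → l ≈ r [ + n ]) (square (rep y)) (eval-cubic (rep x)) (≡mod⇒≈ h) ,
                           ≡mod⇒≈ h′ , ≡mod⇒≈ h″)
        (λ (h , h′ , h″) → ≈⇒≡mod (subst₂ (λ l r → l ≈ r [ + n ])
                             (sym (square (rep y))) (sym (eval-cubic (rep x))) h) ,
                           ≈⇒≡mod h′ , ≈⇒≡mod h″))
      curveCount)
    where
    square : ∀ y → y ^ 2 ≡ y * y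
    square y = cong (y *_) (ℤ.*-identityʳ y)

  discriminant′ : ∀ {j} → j ≤ suc k → + 27 * (+ B + + 2 * c * c * c) * δ ≈ + Δ A B [ + (p ℕ.^ j) ]
  discriminant′ {j} j≤k = subst (λ z → + 27 * (+ B + + 2 * c * c * c) * δ ≈ z [ + (p ℕ.^ j) ])
    (sym (pos-Δ A B)) (≈-∣ (^-∣-^ p j≤k) discriminant)

  ∣Δ⇒δ≈0 : ∀ {j} → j ≤ suc k → p ℕ.^ j ∣ Δ A B → δ ≈ 0ℤ [ + (p ℕ.^ j) ]
  ∣Δ⇒δ≈0 {j} j≤k h = *-cancel-unit pr cofactor≉0 j δ (≈-trans (discriminant′ j≤k) (∣⇒≈0 h))

  δ≈0⇒∣Δ : ∀ {j} → j ≤ suc k → δ ≈ 0ℤ [ + (p ℕ.^ j) ] → p ℕ.^ j ∣ Δ A B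
  δ≈0⇒∣Δ {j} j≤k h = ≈0⇒∣ (≈-trans (≈-sym (discriminant′ j≤k))
    (lin₁ (+ 27 * (+ B + + 2 * c * c * c)) h (lemma (+ 27 * (+ B + + 2 * c * c * c)) δ)))
    where
    lemma : ∀ e x → e * x - 0ℤ ≡ e * (x - 0ℤ)
    lemma = solve-∀

  module _ (s₀ s₁ : ℕ)
           (count-0 : ∀ {δ} → δ ≈ 0ℤ [ 𝕡 ] → smoothCount p (+ 3 * c) δ ≡ s₀)
           (count-≉0 : ∀ {δ} → ¬ δ ≈ 0ℤ [ 𝕡 ] → smoothCount p (+ 3 * c) δ ≡ s₁) where

    open NodeFormula q pr 2≉0 (+ 3 * c) a≉0 s₀ s₁ count-0 count-≉0

    M-low : p ℕ.^ suc k ∣ Δ A B → M (cubic A B) ρ (suc k) ≡ p ℕ.^ k ℕ.* lowFactor p s₀ k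
    M-low h = trans M≡nodeCount (nodeCount-low k 1ℤ δ (∣Δ⇒δ≈0 ℕ.≤-refl h))

    -- Both exponents that pin down the valuation, `suc i` and `suc (suc i)`, are at most `suc k`,
    -- the precision to which δ reflects Δ.
    M-high : ∀ i → i < k → HasValuation p (Δ A B) (fin (suc i)) →
             M (cubic A B) ρ (suc k) ≡ p ℕ.^ k ℕ.* highFactor s₀ s₁ i
    M-high i i<k (h , ¬h) = trans M≡nodeCount
      (subst (λ k → nodeCount (p ℕ.^ suc k) 1ℤ δ ≡ p ℕ.^ k ℕ.* highFactor s₀ s₁ i) (ℕ.m+[n∸m]≡n i<k)
        (nodeCount-high i (k ∸ suc i) 1ℤ δ
          (∣Δ⇒δ≈0 (ℕ.m≤n⇒m≤1+n i<k) h) (¬h ∘ δ≈0⇒∣Δ (ℕ.s≤s i<k))))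

  class : ℤ
  class = - (+ 2) * + A * + B

  module SquareClass (η≡1 : legendre class p ≡ 1ℤ) where

    private
      root-class = square-class (proj₁ (legendre≡1⇒square class p η≡1)) (proj₂ (legendre≡1⇒square class p η≡1))

    count : ∀ δ → smoothCount p (+ 3 * c) δ ≡ q ℕ.* ⟦ δ ≈? 0ℤ [ 𝕡 ] ⟧ ℕ.+ q
    count = OddPrime.square-count q pr 2≉0 (proj₁ root-class) (proj₂ root-class) a≉0

    count-0 : ∀ {δ} → δ ≈ 0ℤ [ 𝕡 ] → smoothCount p (+ 3 * c) δ ≡ q ℕ.+ q
    count-0 {δ} h = trans (count δ) (cong (ℕ._+ q)
      (trans (cong (q ℕ.*_) (⟦⟧-yes (δ ≈? 0ℤ [ 𝕡 ]) h)) (ℕ.*-identityʳ q)))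

    count-≉0 : ∀ {δ} → ¬ δ ≈ 0ℤ [ 𝕡 ] → smoothCount p (+ 3 * c) δ ≡ q
    count-≉0 {δ} h = trans (count δ) (cong (ℕ._+ q)
      (trans (cong (q ℕ.*_) (⟦⟧-no (δ ≈? 0ℤ [ 𝕡 ]) h)) (ℕ.*-zeroʳ q)))

    -- The factor kq + 1 is kp - (k - 1). At `k = 0` the subtracted term is -1, so the formula lives
    -- in ℤ.
    low : p ℕ.^ suc k ∣ Δ A B →
          + M (cubic A B) ρ (suc k) ≡ (+ p) ^ k * ((+ suc k - + 1) * + p - (+ suc k - + 2))
    low h = begin
      + M (cubic A B) ρ (suc k)               ≡⟨ cong +_ (M-low (q ℕ.+ q) q count-0 count-≉0 h) ⟩
      + (p ℕ.^ k ℕ.* lowFactor p (q ℕ.+ q) k) ≡⟨ cong (λ f → + (p ℕ.^ k ℕ.* f)) (lowFactor-square q k) ⟩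
      + (p ℕ.^ k ℕ.* (k ℕ.* q ℕ.+ 1))         ≡⟨ ℤ.pos-* (p ℕ.^ k) (k ℕ.* q ℕ.+ 1) ⟩
      + (p ℕ.^ k) * (+ (k ℕ.* q) + 1ℤ)
        ≡⟨ cong₂ _*_ (pos-^ p k) (trans (cong (_+ 1ℤ) (ℤ.pos-* k q)) (lemma (+ k) (+ q))) ⟩
      (+ p) ^ k * ((+ suc k - + 1) * + p - (+ suc k - + 2)) ∎
      where
      open ≡-Reasoning
      lemma : ∀ k q → k * q + 1ℤ ≡ (1ℤ + k - + 1) * (1ℤ + q) - (1ℤ + k - + 2)
      lemma = solve-∀

    high : ∀ i → i < k → HasValuation p (Δ A B) (fin (suc i)) →
           + M (cubic A B) ρ (suc k) ≡ (+ p) ^ k * (+ suc i - + 1) * (+ p - + 1)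
    high i i<k v = begin
      + M (cubic A B) ρ (suc k)                    ≡⟨ cong +_ (M-high (q ℕ.+ q) q count-0 count-≉0 i i<k v) ⟩
      + (p ℕ.^ k ℕ.* highFactor (q ℕ.+ q) q i)     ≡⟨ cong (λ f → + (p ℕ.^ k ℕ.* f)) (highFactor-square q i) ⟩
      + (p ℕ.^ k ℕ.* (i ℕ.* q))                    ≡⟨ ℤ.pos-* (p ℕ.^ k) (i ℕ.* q) ⟩
      + (p ℕ.^ k) * + (i ℕ.* q)                    ≡⟨ cong₂ _*_ (pos-^ p k) (ℤ.pos-* i q) ⟩
      (+ p) ^ k * (+ i * + q)                      ≡⟨ lemma ((+ p) ^ k) (+ i) (+ q) ⟩
      (+ p) ^ k * (+ suc i - + 1) * (+ p - + 1)    ∎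
      where
      open ≡-Reasoning
      lemma : ∀ n i q → n * (i * q) ≡ n * (1ℤ + i - + 1) * (1ℤ + q - + 1)
      lemma = solve-∀

  module NonSquareClass (η≡-1 : legendre class p ≡ -1ℤ) where

    open OddPrime.NonSquare q pr 2≉0 (+ 3 * c) (nonsquare-class (legendre≡-1⇒nonsquare class p η≡-1))
      using (smoothCount-zero; smoothCount-nonzero)

    low : p ℕ.^ suc k ∣ Δ A B → + M (cubic A B) ρ (suc k) ≡ (+ p) ^ (2 ℕ.* (suc k / 2))
    low h = trans
      (cong +_ (trans (M-low 0 (suc p) smoothCount-zero smoothCount-nonzero h) (lowFactor-nonsquare p k)))
      (pos-^ p (2 ℕ.* (suc k / 2)))

    high-odd : ∀ i → i < k → HasValuation p (Δ A B) (fin (suc i)) → ¬ (2 ∣ suc i) →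
               + M (cubic A B) ρ (suc k) ≡ + 0
    high-odd i i<k v odd = cong +_ (trans (M-high 0 (suc p) smoothCount-zero smoothCount-nonzero i i<k v)
      (trans (cong (p ℕ.^ k ℕ.*_) (highFactor-odd (suc p) i odd)) (ℕ.*-zeroʳ (p ℕ.^ k))))

    high-even : ∀ i → i < k → HasValuation p (Δ A B) (fin (suc i)) → 2 ∣ suc i →
                + M (cubic A B) ρ (suc k) ≡ (+ p) ^ k * (+ p + + 1)
    high-even i i<k v even = begin
      + M (cubic A B) ρ (suc k)
        ≡⟨ cong +_ (M-high 0 (suc p) smoothCount-zero smoothCount-nonzero i i<k v) ⟩
      + (p ℕ.^ k ℕ.* highFactor 0 (suc p) i)
        ≡⟨ cong (λ f → + (p ℕ.^ k ℕ.* f)) (highFactor-even (suc p) i even) ⟩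
      + (p ℕ.^ k ℕ.* suc p)
        ≡⟨ ℤ.pos-* (p ℕ.^ k) (suc p) ⟩
      + (p ℕ.^ k) * + suc p
        ≡⟨ cong₂ _*_ (pos-^ p k) (ℤ.+-comm 1ℤ (+ p)) ⟩
      (+ p) ^ k * (+ p + + 1) ∎
      where open ≡-Reasoning

theorem11 :
  (p A B : ℕ) → Prime p → 5 ≤ p →
  p ∣ Δ A B → ¬ (p ∣ A) →
  (m : ℕ∞) → HasValuation p (Δ A B) m →
  (ρ : Fin p) → RepeatedRoot p (cubic A B) ρ →
  (k : ℕ) → 1 ≤ k →
  let η = legendre (- (+ 2) * + A * + B) p
      Mₖ = + M (cubic A B) ρ k
  in
  (η ≡ 1ℤ →
    (fin k ≤∞ m →
      Mₖ ≡ (+ p) ^ (k ∸ 1) * ((+ k - + 1) * + p - (+ k - + 2))) ×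
    ((n : ℕ) → m ≡ fin n → n < k →
      Mₖ ≡ (+ p) ^ (k ∸ 1) * (+ n - + 1) * (+ p - + 1))) ×
  (η ≡ -1ℤ →
    (fin k ≤∞ m →
      Mₖ ≡ (+ p) ^ (2 ℕ.* (k / 2))) ×
    ((n : ℕ) → m ≡ fin n → n < k → ¬ (2 ∣ n) →
      Mₖ ≡ + 0) ×
    ((n : ℕ) → m ≡ fin n → n < k → 2 ∣ n →
      Mₖ ≡ (+ p) ^ (k ∸ 1) * (+ p + + 1)))
theorem11 (suc q) A B pr 5≤p p∣Δ p∤A m v ρ repeated (suc k) _ =
  (λ η≡1 → let open SquareClass η≡1 in
     (λ k≤m → low (≤∞⇒^-∣ m v k≤m)) ,
     -- As p ∣ Δ, the valuation is positive, so it has the form `suc i` that the shifted index of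
     -- `highFactor` expects.
     λ { zero refl _ → contradiction p∣Δ (p∤Δ v)
       ; (suc i) refl n<k → high i (ℕ.s≤s⁻¹ n<k) v }) ,
  (λ η≡-1 → let open NonSquareClass η≡-1 in
     (λ k≤m → low (≤∞⇒^-∣ m v k≤m)) ,
     (λ { zero refl _ → contradiction p∣Δ (p∤Δ v)
        ; (suc i) refl n<k → high-odd i (ℕ.s≤s⁻¹ n<k) v }) ,
     λ { zero refl _ → contradiction p∣Δ (p∤Δ v)
       ; (suc i) refl n<k → high-even i (ℕ.s≤s⁻¹ n<k) v })
  where
  open Count q A B pr 5≤p p∤A ρ repeated k
  p∤Δ : HasValuation (suc q) (Δ A B) (fin 0) → ¬ (suc q ∣ Δ A B)
  p∤Δ (_ , ¬d) d = ¬d (subst (_∣ Δ A B) (sym (ℕ.*-identityʳ (suc q))) d)
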